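{- Assume the univalence axiom. Let $A\xrightarrow{i}E\xrightarrow{p}B$ be a short exact sequence of abelian groups (call it $\mathcal E\in\mathrm{AbSES}(B,A)$) and $G$ an abelian group. Then for every $n\ge 1$ the sequence of pointed sets \[ \mathrm{Ext}^n(E,G)\xrightarrow{i^*}\mathrm{Ext}^n(A,G)\xrightarrow{ -\rhd\mathcal E}\mathrm{Ext}^{n+1}(B,G)\xrightarrow{p^*}\mathrm{Ext}^{n+1}(E,G)\xrightarrow{i^*}\mathrm{Ext}^{n+1}(A,G) \] is exact at $\mathrm{Ext}^n(A,G)$, at $\mathrm{Ext}^{n+1}(B,G)$ and at $\mathrm{Ext}^{n+1}(E,G)$; here $i^*,p^*$ are given by pulling back and $-\rhd\mathcal E$ by splicing with $\mathcal E$.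
   Context: We work in homotopy type theory with univalence. For abelian groups $X,Y$, $\mathrm{AbSES}(Y,X)$ is the type of short exact sequences $(M,j,q)$: $M$ abelian, $j:X\to M$ injective, $q:M\to Y$ surjective, $q\circ j=0$, $X\to\ker q$ surjective; pointed by $X\to X\oplus Y\to Y$. Pullback $g^*$ along $g:Y'\to Y$ replaces $M$ by $M\times_Y Y'$; pushout $f_*$ along $f:X\to X'$ replaces $M$ by $(X'\oplus M)/\{(f(x),-j(x))\}$. Define types $\mathrm{ES}^n(Y,X)$: $\mathrm{ES}^0(Y,X)=\mathrm{Hom}(Y,X)$, $\mathrm{ES}^1(Y,X)=\mathrm{AbSES}(Y,X)$, and for $n\ge1$, $\mathrm{ES}^{n+1}(Y,X)=\sum_{M:\mathrm{AbGroup}}\mathrm{ES}^n(M,X)\times\mathrm{AbSES}(Y,M)$, whose elements are written $(F,E')_M$; it is pointed recursively using the trivial group for $M$. Pullback along $g:Y'\to Y$ acts on $\mathrm{ES}^{n+1}$ by pulling back the $\mathrm{AbSES}(Y,M)$ component, and pushout along $f:X\to X'$ acts by pushing out the $\mathrm{ES}^n(M,X)$ component (recursively). For $n\ge1$, splicing is $F\rhd E':=(F,E')_Y:\mathrm{ES}^{n+1}(Z,X)$ for $F:\mathrm{ES}^n(Y,X)$, $E':\mathrm{AbSES}(Z,Y)$. The relation $\mathrm{zig}$ on $\mathrm{ES}^n(Y,X)$ is the identity type for $n=0,1$, and for $n\ge1$ a zig from $(F,E')_M$ to $(F',E'')_N$ in $\mathrm{ES}^{n+1}$ consists of a homomorphism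 $h:M\to N$, a path $h_*(E')=E''$ and a zig from $F$ to $h^*(F')$. $\mathrm{Ext}^n(Y,X)$ is the quotient of $\mathrm{ES}^n(Y,X)$ by the (propositionally truncated) equivalence relation generated by $\mathrm{zig}$; it is a pointed set, pullback and pushout descend to it, and splicing descends to $\mathrm{Ext}^n(Y,X)\times\mathrm{AbSES}(Z,Y)\to\mathrm{Ext}^{n+1}(Z,X)$. A sequence of pointed sets $S\xrightarrow{u}T\xrightarrow{v}U$ is exact at $T$ if the image of $u$ equals the preimage under $v$ of the base point. -}

{-# OPTIONS --without-K #-}

module Defs where

open import Level using (Level; Setω; _⊔_; Lift; lift) renaming (suc to lsuc)
open import Data.Nat.Base using (ℕ; zero; suc)
open import Data.Product.Base using (Σ; ∃; _×_; _,_; proj₁; proj₂)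
open import Data.Unit.Polymorphic.Base using (⊤; tt)
open import Function.Base using (id; _∘_)
open import Function.Bundles using (_⇔_)
open import Function.Definitions using (Injective)
open import Relation.Binary.PropositionalEquality
  using (_≡_; refl; sym; trans; cong; cong₂; subst; isEquivalence; module ≡-Reasoning)
open import Relation.Binary.Core using (Rel)
open import Relation.Binary.Structures using (IsEquivalence)
open import Relation.Binary.Construct.Closure.Equivalence as EqC using (EqClosure)
open import Relation.Binary.Construct.Closure.ReflexiveTransitive using () renaming (return to return⋆)
open import Relation.Binary.Construct.Closure.Symmetric using (fwd)
open import Relation.Nullary.Irrelevant using () renaming (Irrelevant to isProp)
open import Axiom.UniquenessOfIdentityProofs using (module Constant⇒UIP) renaming (UIP to isSet)
open import Axiom.Extensionality.Propositional using (Extensionality; implicit-extensionality)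
open import Algebra.Bundles using (AbelianGroup)
open import Algebra.Structures using (IsMagma; IsSemigroup; IsMonoid; IsGroup; IsAbelianGroup)
open import Algebra.Morphism.Structures using (module GroupMorphisms)
import Algebra.Properties.AbelianGroup as AbelianGroupProperties

private variable
  a b p r ℓ : Level

isContr : Set a → Set a
isContr A = Σ A λ c → ∀ x → c ≡ x

fiber : {A : Set a} {B : Set b} → (A → B) → B → Set (a ⊔ b)
fiber f y = ∃ λ x → f x ≡ y

isEquiv : {A : Set a} {B : Set b} → (A → B) → Set (a ⊔ b)
isEquiv f = ∀ y → isContr (fiber f y)

_≃_ : Set a → Set b → Set (a ⊔ b)
A ≃ B = Σ (A → B) isEquiv

id-isEquiv : {A : Set a} → isEquiv (id {A = A})
id-isEquiv y = (y , refl) , λ { (_ , refl) → refl }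

idtoeqv : {A B : Set a} → A ≡ B → A ≃ B
idtoeqv refl = id , id-isEquiv

-- Refutable in the presence of axiom K: everything that depends on this
-- hypothesis has to be read, and checked, with --without-K.
Univalence : Setω
Univalence = ∀ {a} {A B : Set a} → isEquiv (idtoeqv {a} {A} {B})

-- Propositional truncation and set quotients are not definable as data
-- types, so they are assumed through their constructors and elimination
-- principles, with propositional computation rules.
record HITs : Setω where
  field
    ∥_∥       : Set a → Set a
    ∣_∣       : {A : Set a} → A → ∥ A ∥
    squash    : {A : Set a} → isProp ∥ A ∥
    trunc-rec : {A : Set a} {P : Set p} → isProp P → (A → P) → ∥ A ∥ → P

    _/_         : (A : Set a) → Rel A r → Set (a ⊔ r)
    [_]         : {A : Set a} {R : Rel A r} → A → A / R
    quot-eq     : {A : Set a} {R : Rel A r} {x y : A} → R x y → [_] {R = R} x ≡ [ y ]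
    quot-set    : {A : Set a} {R : Rel A r} → isSet (A / R)
    quot-elim   : {A : Set a} {R : Rel A r} (P : A / R → Set p) →
                  (∀ c → isSet (P c)) →
                  (f : ∀ x → P [ x ]) →
                  (∀ {x y} (s : R x y) → subst P (quot-eq s) (f x) ≡ f y) →
                  ∀ c → P c
    quot-elim-β : {A : Set a} {R : Rel A r} (P : A / R → Set p)
                  (P-set : ∀ c → isSet (P c))
                  (f : ∀ x → P [ x ])
                  (f-eq : ∀ {x y} (s : R x y) → subst P (quot-eq s) (f x) ≡ f y) →
                  ∀ x → quot-elim P P-set f f-eq [ x ] ≡ f x

  infix 5 _/_

record AbGroup (ℓ : Level) : Set (lsuc ℓ) where
  no-eta-equality; pattern
  constructor mkAbGroup
  infixl 7 _∙_
  infix  8 _⁻¹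
  field
    Carrier        : Set ℓ
    carrier-set    : isSet Carrier
    _∙_            : Carrier → Carrier → Carrier
    ε              : Carrier
    _⁻¹            : Carrier → Carrier
    isAbelianGroup : IsAbelianGroup _≡_ _∙_ ε _⁻¹

  abelianGroup : AbelianGroup ℓ ℓ
  abelianGroup = record { isAbelianGroup = isAbelianGroup }

  open AbelianGroup abelianGroup public
    using (assoc; comm; identityˡ; identityʳ; inverseˡ; inverseʳ; rawGroup)
  open AbelianGroupProperties abelianGroup public
    using (inverseˡ-unique; ε⁻¹≈ε; x∙y⁻¹≈ε⇒x≈y; ⁻¹-∙-comm)

open AbGroup using (Carrier; carrier-set)

record Hom (X Y : AbGroup ℓ) : Set ℓ where
  no-eta-equality; pattern
  constructor mkHom
  private
    module X = AbGroup X
    module Y = AbGroup Y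
  open GroupMorphisms X.rawGroup Y.rawGroup using (IsGroupHomomorphism)
  field
    ⟦_⟧                 : X.Carrier → Y.Carrier
    isGroupHomomorphism : IsGroupHomomorphism ⟦_⟧

  open IsGroupHomomorphism isGroupHomomorphism public
    using (homo; ε-homo; ⁻¹-homo)

open Hom using (⟦_⟧)

module _ {X Y : AbGroup ℓ} where
  private
    module X = AbGroup X
    module Y = AbGroup Y
  open GroupMorphisms X.rawGroup Y.rawGroup using (IsGroupHomomorphism)
  open ≡-Reasoning

  opaque
    ∙-isGroupHomomorphism :
      (f : X.Carrier → Y.Carrier) → (∀ x y → f (x X.∙ y) ≡ f x Y.∙ f y) → IsGroupHomomorphism f
    ∙-isGroupHomomorphism f f-∙ = record
      { isMonoidHomomorphism = record
        { isMagmaHomomorphism = record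
          { isRelHomomorphism = record { cong = cong f }
          ; homo = f-∙
          }
        ; ε-homo = f-ε
        }
      ; ⁻¹-homo = λ x → Y.inverseˡ-unique _ _ (begin
          f (x X.⁻¹) Y.∙ f x  ≡⟨ f-∙ _ _ ⟨
          f (x X.⁻¹ X.∙ x)    ≡⟨ cong f (X.inverseˡ x) ⟩
          f X.ε               ≡⟨ f-ε ⟩
          Y.ε                 ∎)
      }
      where
      f-ε : f X.ε ≡ Y.ε
      f-ε = begin
        f X.ε                                  ≡⟨ Y.identityʳ _ ⟨
        f X.ε Y.∙ Y.ε                          ≡⟨ cong (f X.ε Y.∙_) (Y.inverseʳ _) ⟨
        f X.ε Y.∙ (f X.ε Y.∙ f X.ε Y.⁻¹)       ≡⟨ Y.assoc _ _ _ ⟨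
        f X.ε Y.∙ f X.ε Y.∙ f X.ε Y.⁻¹         ≡⟨ cong (Y._∙ f X.ε Y.⁻¹) (f-∙ _ _) ⟨
        f (X.ε X.∙ X.ε) Y.∙ f X.ε Y.⁻¹         ≡⟨ cong (λ x → f x Y.∙ f X.ε Y.⁻¹) (X.identityˡ _) ⟩
        f X.ε Y.∙ f X.ε Y.⁻¹                   ≡⟨ Y.inverseʳ _ ⟩
        Y.ε                                    ∎

  ∙-Hom : (f : X.Carrier → Y.Carrier) → (∀ x y → f (x X.∙ y) ≡ f x Y.∙ f y) → Hom X Y
  ∙-Hom f f-∙ = mkHom f (∙-isGroupHomomorphism f f-∙)

idHom : {X : AbGroup ℓ} → Hom X X
idHom = ∙-Hom id λ _ _ → refl

module _ {X Y Z : AbGroup ℓ} where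
  open GroupMorphisms (AbGroup.rawGroup X) (AbGroup.rawGroup Z) using (IsGroupHomomorphism)

  opaque
    ∘-isGroupHomomorphism : (g : Hom Y Z) (f : Hom X Y) → IsGroupHomomorphism (⟦ g ⟧ ∘ ⟦ f ⟧)
    ∘-isGroupHomomorphism g f = ∙-isGroupHomomorphism {X = X} {Z} _ λ x y →
      trans (cong ⟦ g ⟧ (Hom.homo f x y)) (Hom.homo g _ _)

  _∘ₕ_ : Hom Y Z → Hom X Y → Hom X Z
  g ∘ₕ f = mkHom (⟦ g ⟧ ∘ ⟦ f ⟧) (∘-isGroupHomomorphism g f)

zeroHom : {X Y : AbGroup ℓ} → Hom X Y
zeroHom {Y = Y} = ∙-Hom (λ _ → ε) λ _ _ → sym (identityˡ ε)
  where open AbGroup Y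

opaque
  ≡-isAbelianGroup : {C : Set ℓ} {_∙_ : C → C → C} {ε : C} {_⁻¹ : C → C} →
                     (∀ x y z → (x ∙ y) ∙ z ≡ x ∙ (y ∙ z)) → (∀ x y → x ∙ y ≡ y ∙ x) →
                     (∀ x → ε ∙ x ≡ x) → (∀ x → (x ⁻¹) ∙ x ≡ ε) →
                     IsAbelianGroup _≡_ _∙_ ε _⁻¹
  ≡-isAbelianGroup {_∙_ = _∙_} {_⁻¹ = _⁻¹} assoc comm idˡ invˡ = record
    { isGroup = record
      { isMonoid = record
        { isSemigroup = record
          { isMagma = record { isEquivalence = isEquivalence ; ∙-cong = cong₂ _∙_ }
          ; assoc = assoc
          }
        ; identity = idˡ , λ x → trans (comm _ _) (idˡ x)
        }
      ; inverse = invˡ , λ x → trans (comm _ _) (invˡ x)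
      ; ⁻¹-cong = cong _⁻¹
      }
    ; comm = comm
    }

opaque
  ×-set : {A : Set a} {B : Set b} → isSet A → isSet B → isSet (A × B)
  ×-set {A = A} {B} A-set B-set = Constant⇒UIP.≡-irrelevant to to-const
    where
    to : {u v : A × B} → u ≡ v → u ≡ v
    to e = cong₂ _,_ (cong proj₁ e) (cong proj₂ e)
    to-const : {u v : A × B} (d e : u ≡ v) → to d ≡ to e
    to-const d e = cong₂ (cong₂ _,_) (A-set (cong proj₁ d) (cong proj₁ e)) (B-set (cong proj₂ d) (cong proj₂ e))

prop⇒set : {A : Set a} → isProp A → isSet A
prop⇒set A-prop = Constant⇒UIP.≡-irrelevant (λ _ → A-prop _ _) (λ _ _ → refl)

Σ-prop-≡ : {A : Set a} {B : A → Set b} → (∀ x → isProp (B x)) →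
           {u v : Σ A B} → proj₁ u ≡ proj₁ v → u ≡ v
Σ-prop-≡ B-prop {x , _} {.x , _} refl = cong (x ,_) (B-prop x _ _)

opaque
  Σ-prop-set : {A : Set a} {B : A → Set b} → isSet A → (∀ x → isProp (B x)) → isSet (Σ A B)
  Σ-prop-set {A = A} {B} A-set B-prop = Constant⇒UIP.≡-irrelevant to to-const
    where
    to : {u v : Σ A B} → u ≡ v → u ≡ v
    to e = Σ-prop-≡ B-prop (cong proj₁ e)
    to-const : {u v : Σ A B} (d e : u ≡ v) → to d ≡ to e
    to-const d e = cong (Σ-prop-≡ B-prop) (A-set (cong proj₁ d) (cong proj₁ e))

×-prop : {A : Set a} {B : Set b} → isProp A → isProp B → isProp (A × B)
×-prop A-prop B-prop (_ , _) (_ , _) = cong₂ _,_ (A-prop _ _) (B-prop _ _)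

𝟘 : AbGroup ℓ
𝟘 = record
  { Carrier        = ⊤
  ; carrier-set    = prop⇒set λ _ _ → refl
  ; _∙_            = λ _ _ → tt
  ; ε              = tt
  ; _⁻¹            = λ _ → tt
  ; isAbelianGroup = ≡-isAbelianGroup (λ _ _ _ → refl) (λ _ _ → refl) (λ _ → refl) (λ _ → refl)
  }

module _ (X Y : AbGroup ℓ) where
  private
    module X = AbGroup X
    module Y = AbGroup Y

  infixr 6 _⊕_

  opaque
    ⊕-isAbelianGroup : IsAbelianGroup {A = X.Carrier × Y.Carrier} _≡_
      (λ (x , y) (x′ , y′) → x X.∙ x′ , y Y.∙ y′) (X.ε , Y.ε) (λ (x , y) → x X.⁻¹ , y Y.⁻¹)
    ⊕-isAbelianGroup = ≡-isAbelianGroup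
      (λ _ _ _ → cong₂ _,_ (X.assoc _ _ _) (Y.assoc _ _ _))
      (λ _ _ → cong₂ _,_ (X.comm _ _) (Y.comm _ _))
      (λ _ → cong₂ _,_ (X.identityˡ _) (Y.identityˡ _))
      (λ _ → cong₂ _,_ (X.inverseˡ _) (Y.inverseˡ _))

    ⊕-set : isSet (X.Carrier × Y.Carrier)
    ⊕-set = ×-set X.carrier-set Y.carrier-set

  _⊕_ : AbGroup ℓ
  _⊕_ = record
    { Carrier        = X.Carrier × Y.Carrier
    ; carrier-set    = ⊕-set
    ; _∙_            = λ (x , y) (x′ , y′) → x X.∙ x′ , y Y.∙ y′
    ; ε              = X.ε , Y.ε
    ; _⁻¹            = λ (x , y) → x X.⁻¹ , y Y.⁻¹
    ; isAbelianGroup = ⊕-isAbelianGroup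
    }

module _ {X Y : AbGroup ℓ} where
  private
    module X = AbGroup X
    module Y = AbGroup Y

  private
    opaque
      inˡ-homo : ∀ x x′ → _≡_ {A = X.Carrier × Y.Carrier} (x X.∙ x′ , Y.ε) (x X.∙ x′ , Y.ε Y.∙ Y.ε)
      inˡ-homo _ _ = cong (_ ,_) (sym (Y.identityˡ _))

      inʳ-homo : ∀ y y′ → _≡_ {A = X.Carrier × Y.Carrier} (X.ε , y Y.∙ y′) (X.ε X.∙ X.ε , y Y.∙ y′)
      inʳ-homo _ _ = cong (_, _) (sym (X.identityˡ _))

  inˡ : Hom X (X ⊕ Y)
  inˡ = ∙-Hom (λ x → x , Y.ε) inˡ-homo

  inʳ : Hom Y (X ⊕ Y)
  inʳ = ∙-Hom (λ y → X.ε , y) inʳ-homo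

  outʳ : Hom (X ⊕ Y) Y
  outʳ = ∙-Hom proj₂ λ _ _ → refl

module _ {M Y Y′ : AbGroup ℓ} (q : Hom M Y) (g : Hom Y′ Y) where
  private
    module M  = AbGroup M
    module Y  = AbGroup Y
    module Y′ = AbGroup Y′

    Agree : M.Carrier × Y′.Carrier → Set _
    Agree (m , y) = ⟦ q ⟧ m ≡ ⟦ g ⟧ y

    _+_ : Σ _ Agree → Σ _ Agree → Σ _ Agree
    ((m , y) , e) + ((m′ , y′) , e′) = (m M.∙ m′ , y Y′.∙ y′) , agree
      where
      opaque
        agree : Agree (m M.∙ m′ , y Y′.∙ y′)
        agree = trans (Hom.homo q _ _) (trans (cong₂ Y._∙_ e e′) (sym (Hom.homo g _ _)))

    𝟎 : Σ _ Agree
    𝟎 = (M.ε , Y′.ε) , agree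
      where
      opaque
        agree : Agree (M.ε , Y′.ε)
        agree = trans (Hom.ε-homo q) (sym (Hom.ε-homo g))

    -_ : Σ _ Agree → Σ _ Agree
    - ((m , y) , e) = (m M.⁻¹ , y Y′.⁻¹) , agree
      where
      opaque
        agree : Agree (m M.⁻¹ , y Y′.⁻¹)
        agree = trans (Hom.⁻¹-homo q _) (trans (cong Y._⁻¹ e) (sym (Hom.⁻¹-homo g _)))

  opaque
    pullback-≡ : {u v : Σ _ Agree} →
                 proj₁ (proj₁ u) ≡ proj₁ (proj₁ v) → proj₂ (proj₁ u) ≡ proj₂ (proj₁ v) → u ≡ v
    pullback-≡ d e = Σ-prop-≡ (λ _ → Y.carrier-set) (cong₂ _,_ d e)

    Pullback-set : isSet (Σ _ Agree)
    Pullback-set = Σ-prop-set (×-set M.carrier-set Y′.carrier-set) (λ _ → Y.carrier-set)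

    Pullback-isAbelianGroup : IsAbelianGroup _≡_ _+_ 𝟎 -_
    Pullback-isAbelianGroup = ≡-isAbelianGroup
      (λ _ _ _ → pullback-≡ (M.assoc _ _ _) (Y′.assoc _ _ _))
      (λ _ _ → pullback-≡ (M.comm _ _) (Y′.comm _ _))
      (λ _ → pullback-≡ (M.identityˡ _) (Y′.identityˡ _))
      (λ _ → pullback-≡ (M.inverseˡ _) (Y′.inverseˡ _))

  Pullback : AbGroup _
  Pullback = record
    { Carrier        = Σ (M.Carrier × Y′.Carrier) Agree
    ; carrier-set    = Pullback-set
    ; _∙_            = _+_
    ; ε              = 𝟎
    ; _⁻¹            = -_
    ; isAbelianGroup = Pullback-isAbelianGroup
    }

module UnivalenceProperties (ua : Univalence) where

  ua-path : {A B : Set a} (e : A ≃ B) → Σ (A ≡ B) λ c → proj₁ (idtoeqv c) ≡ proj₁ e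
  ua-path e with proj₁ (ua e)
  ... | c , c≡e = c , cong proj₁ c≡e

  opaque
    -- Voevodsky's argument: post-composition with the equivalence
    -- Σ A B → A is an equivalence, and Π A B is a retract of its fibre
    -- over the identity.
    Π-contr : {A : Set ℓ} {B : A → Set ℓ} → (∀ x → isContr (B x)) → isContr (∀ x → B x)
    Π-contr {A = A} {B} B-contr = from (proj₁ contr) , λ f → cong from (proj₂ contr (to f))
      where
      proj₁-isEquiv : isEquiv (proj₁ {A = A} {B = B})
      proj₁-isEquiv x = ((x , proj₁ (B-contr x)) , refl) ,
        λ { ((.x , y) , refl) → cong (λ z → (x , z) , refl) (proj₂ (B-contr x) y) }

      post : {X Y : Set ℓ} (c : X ≡ Y) → isEquiv (λ (g : A → X) → proj₁ (idtoeqv c) ∘ g)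
      post refl = id-isEquiv

      contr : isContr (fiber (λ (g : A → Σ A B) → proj₁ ∘ g) id)
      contr with ua-path (proj₁ , proj₁-isEquiv)
      ... | c , c≡ = subst (λ k → isContr (fiber (λ (g : A → Σ A B) → k ∘ g) id)) c≡ (post c id)

      from : fiber (λ (g : A → Σ A B) → proj₁ ∘ g) id → ∀ x → B x
      from (g , e) x = subst B (cong (λ k → k x) e) (proj₂ (g x))

      to : (∀ x → B x) → fiber (λ (g : A → Σ A B) → proj₁ ∘ g) id
      to f = (λ x → x , f x) , refl

  opaque
    funext : Extensionality ℓ ℓ
    funext {A = A} {B} {f} {g} h = cong (λ (k : ∀ x → ∃ λ y → f x ≡ y) x → proj₁ (k x)) f≡g
      where
      contr : isContr (∀ x → ∃ λ y → f x ≡ y)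
      contr = Π-contr λ x → (f x , refl) , λ { (_ , refl) → refl }
      f≡g : _≡_ {A = ∀ x → ∃ λ y → f x ≡ y} (λ x → f x , refl) (λ x → g x , h x)
      f≡g = trans (sym (proj₂ contr _)) (proj₂ contr _)

  Π-prop : {A : Set ℓ} {B : A → Set ℓ} → (∀ x → isProp (B x)) → isProp (∀ x → B x)
  Π-prop B-prop f g = funext λ x → B-prop x (f x) (g x)

  Πᵢ-prop : {A : Set ℓ} {B : A → Set ℓ} → (∀ {x} → isProp (B x)) → isProp (∀ {x} → B x)
  Πᵢ-prop B-prop f g = implicit-extensionality funext λ {x} → B-prop {x} (f {x}) (g {x})

  isProp-prop : {A : Set ℓ} → isProp (isProp A)
  isProp-prop h = Π-prop (λ x → Π-prop λ y → prop⇒set h) h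

  isSet-prop : {A : Set ℓ} → isProp (isSet A)
  isSet-prop {A = A} s = Πᵢ-prop (λ {x} → Πᵢ-prop λ {y} → isProp-prop) s

  prop-ext : {P Q : Set ℓ} → isProp P → isProp Q → (P → Q) → (Q → P) → P ≡ Q
  prop-ext P-prop Q-prop to from = proj₁ (ua-path (to , λ y →
    (from y , Q-prop _ _) , λ (x , _) → Σ-prop-≡ (λ _ → prop⇒set Q-prop) (P-prop _ _)))

  hProp : (ℓ : Level) → Set (lsuc ℓ)
  hProp ℓ = Σ (Set ℓ) isProp

  hProp-≡ : {P Q : hProp ℓ} → (proj₁ P → proj₁ Q) → (proj₁ Q → proj₁ P) → P ≡ Q
  hProp-≡ {P = _ , P-prop} {_ , Q-prop} to from =
    Σ-prop-≡ (λ _ → isProp-prop) (prop-ext P-prop Q-prop to from)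

  hProp-set : isSet (hProp ℓ)
  hProp-set {ℓ} = Constant⇒UIP.≡-irrelevant to to-const
    where
    fwd′ : {P Q : hProp ℓ} → P ≡ Q → proj₁ P → proj₁ Q
    fwd′ = subst proj₁
    to : {P Q : hProp ℓ} → P ≡ Q → P ≡ Q
    to {P} {Q} e = hProp-≡ (fwd′ e) (fwd′ (sym e))
    to-const : {P Q : hProp ℓ} (d e : P ≡ Q) → to d ≡ to e
    to-const {P} {Q} d e = cong₂ (hProp-≡ {P = P} {Q})
      (Π-prop (λ _ → proj₂ Q) _ _) (Π-prop (λ _ → proj₂ P) _ _)

  retract-prop : {A : Set a} {B : Set b} (f : A → B) (g : B → A) → (∀ x → g (f x) ≡ x) →
                 isProp B → isProp A
  retract-prop f g gf B-prop x y = trans (sym (gf x)) (trans (cong g (B-prop _ _)) (gf y))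

  module _ {C : Set ℓ} (C-set : isSet C) {_∙_ : C → C → C} {ε : C} {_⁻¹ : C → C} where

    isEquivalence-prop : isProp (IsEquivalence {A = C} _≡_)
    isEquivalence-prop = retract-prop
      (λ e →
        (λ x → IsEquivalence.refl e {x}) ,
        (λ x y → IsEquivalence.sym e {x} {y}) ,
        (λ x y z → IsEquivalence.trans e {x} {y} {z}))
      (λ (r , s , t) → record { refl = r _ ; sym = s _ _ ; trans = t _ _ _ })
      (λ _ → refl)
      (×-prop (Π-prop λ _ → C-set)
      (×-prop (Π-prop λ _ → Π-prop λ _ → Π-prop λ _ → C-set)
              (Π-prop λ _ → Π-prop λ _ → Π-prop λ _ → Π-prop λ _ → Π-prop λ _ → C-set)))

    isMagma-prop : isProp (IsMagma _≡_ _∙_)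
    isMagma-prop = retract-prop
      (λ m → let open IsMagma m using (∙-cong) in IsMagma.isEquivalence m , (λ x y u v → ∙-cong {x} {y} {u} {v}))
      (λ (e , c) → record { isEquivalence = e ; ∙-cong = c _ _ _ _ })
      (λ _ → refl)
      (×-prop isEquivalence-prop
              (Π-prop λ _ → Π-prop λ _ → Π-prop λ _ → Π-prop λ _ → Π-prop λ _ → Π-prop λ _ → C-set))

    isMonoid-prop : isProp (IsMonoid _≡_ _∙_ ε)
    isMonoid-prop = retract-prop
      (λ m → let open IsMonoid m using (isMagma; assoc; identity) in isMagma , assoc , identity)
      (λ (m , as , i) → record { isSemigroup = record { isMagma = m ; assoc = as } ; identity = i })
      (λ _ → refl)
      (×-prop isMagma-prop
      (×-prop (Π-prop λ _ → Π-prop λ _ → Π-prop λ _ → C-set)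
      (×-prop (Π-prop λ _ → C-set) (Π-prop λ _ → C-set))))

    isAbelianGroup-prop : isProp (IsAbelianGroup _≡_ _∙_ ε _⁻¹)
    isAbelianGroup-prop = retract-prop
      (λ g → let open IsAbelianGroup g using (isMonoid; inverse; ⁻¹-cong; comm) in
        isMonoid , inverse , (λ x y → ⁻¹-cong {x} {y}) , comm)
      (λ (m , v , vc , c) → record
        { isGroup = record { isMonoid = m ; inverse = v ; ⁻¹-cong = vc _ _ } ; comm = c })
      (λ _ → refl)
      (×-prop isMonoid-prop
      (×-prop (×-prop (Π-prop λ _ → C-set) (Π-prop λ _ → C-set))
      (×-prop (Π-prop λ _ → Π-prop λ _ → Π-prop λ _ → C-set)
              (Π-prop λ _ → Π-prop λ _ → C-set))))

  hom-≡ : {X Y : AbGroup ℓ} {f g : Hom X Y} → (∀ x → ⟦ f ⟧ x ≡ ⟦ g ⟧ x) → f ≡ g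
  hom-≡ {X = X} {Y} {mkHom f hf} {mkHom g hg} f≗g with funext f≗g
  ... | refl = cong (mkHom f) (isGroupHomomorphism-prop hf hg)
    where
    open GroupMorphisms (AbGroup.rawGroup X) (AbGroup.rawGroup Y)
    isGroupHomomorphism-prop : isProp (IsGroupHomomorphism f)
    isGroupHomomorphism-prop = retract-prop
      (λ h → let open IsGroupHomomorphism h in (λ x y → ⟦⟧-cong {x} {y}) , homo , ε-homo , ⁻¹-homo)
      (λ (k , h , e , v) → record
        { isMonoidHomomorphism = record
          { isMagmaHomomorphism = record { isRelHomomorphism = record { cong = k _ _ } ; homo = h }
          ; ε-homo = e }
        ; ⁻¹-homo = v })
      (λ _ → refl)
      (×-prop (Π-prop λ _ → Π-prop λ _ → Π-prop λ _ → Y-set)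
      (×-prop (Π-prop λ _ → Π-prop λ _ → Y-set)
      (×-prop Y-set (Π-prop λ _ → Y-set))))
      where
      Y-set : isSet (Carrier Y)
      Y-set = carrier-set Y

  opaque
    abGroup-path : {M N : AbGroup ℓ} (φ : Hom M N) → isEquiv ⟦ φ ⟧ →
                   Σ (M ≡ N) λ e → ∀ m → subst Carrier e m ≡ ⟦ φ ⟧ m
    abGroup-path {M = M@(mkAbGroup _ _ _ _ _ _)} {N@(mkAbGroup _ _ _ _ _ _)} φ φ-equiv with ua-path (⟦ φ ⟧ , φ-equiv)
    ... | c , c≡φ = along c ⟦ φ ⟧ (λ m → cong (λ k → k m) c≡φ)
                      N.isAbelianGroup N.carrier-set (Hom.homo φ) (Hom.ε-homo φ) (Hom.⁻¹-homo φ)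
      where
      module M = AbGroup M
      module N = AbGroup N

      same : {_∙_ : M.Carrier → M.Carrier → M.Carrier} {ε : M.Carrier} {_⁻¹ : M.Carrier → M.Carrier} →
             M._∙_ ≡ _∙_ → M.ε ≡ ε → M._⁻¹ ≡ _⁻¹ →
             (ag : IsAbelianGroup _≡_ _∙_ ε _⁻¹) (s : isSet M.Carrier) →
             Σ (M ≡ mkAbGroup M.Carrier s _∙_ ε _⁻¹ ag) λ e → ∀ m → subst Carrier e m ≡ m
      same refl refl refl ag s = same′
        (isSet-prop M.carrier-set s) (isAbelianGroup-prop M.carrier-set M.isAbelianGroup ag)
        where
        same′ : {s : isSet M.Carrier} {ag : IsAbelianGroup _≡_ M._∙_ M.ε M._⁻¹} →
                (λ {x y} → M.carrier-set {x} {y}) ≡ s → M.isAbelianGroup ≡ ag →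
                Σ (M ≡ mkAbGroup M.Carrier s M._∙_ M.ε M._⁻¹ ag) λ e → ∀ m → subst Carrier e m ≡ m
        same′ refl refl = refl , λ _ → refl

      along : {C : Set _} (c : M.Carrier ≡ C) (f : M.Carrier → C) →
              (∀ m → proj₁ (idtoeqv c) m ≡ f m) →
              {_∙_ : C → C → C} {ε : C} {_⁻¹ : C → C} →
              (ag : IsAbelianGroup _≡_ _∙_ ε _⁻¹) (s : isSet C) →
              (∀ x y → f (x M.∙ y) ≡ f x ∙ f y) → f M.ε ≡ ε → (∀ x → f (x M.⁻¹) ≡ f x ⁻¹) →
              Σ (M ≡ mkAbGroup C s _∙_ ε _⁻¹ ag) λ e → ∀ m → subst Carrier e m ≡ f m
      along refl f id≗f {_∙_} {ε} {_⁻¹} ag s f-∙ f-ε f-⁻¹ =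
        let e , e-id = same
              (funext λ x → funext λ y →
                trans (id≗f _) (trans (f-∙ x y) (sym (cong₂ _∙_ (id≗f x) (id≗f y)))))
              (trans (id≗f _) f-ε)
              (funext λ x → trans (id≗f _) (trans (f-⁻¹ x) (sym (cong _⁻¹ (id≗f x)))))
              ag s
        in e , λ m → trans (e-id m) (id≗f m)

module HITProperties (hits : HITs) where
  open HITs hits

  trunc-map : {A : Set a} {B : Set b} → (A → B) → ∥ A ∥ → ∥ B ∥
  trunc-map f = trunc-rec squash (∣_∣ ∘ f)

  module _ {A : Set a} {R : Rel A r} where

    subst-const : {B : Set p} {c d : A / R} (e : c ≡ d) (x : B) → subst (λ _ → B) e x ≡ x
    subst-const refl x = refl

    module _ {B : Set p} (B-set : isSet B) (f : A → B) (f-eq : ∀ {x y} → R x y → f x ≡ f y) where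

      quot-rec : A / R → B
      quot-rec = quot-elim (λ _ → B) (λ _ → B-set) f λ s → trans (subst-const _ _) (f-eq s)

      quot-rec-β : ∀ x → quot-rec [ x ] ≡ f x
      quot-rec-β = quot-elim-β (λ _ → B) (λ _ → B-set) f λ s → trans (subst-const _ _) (f-eq s)

    quot-elimProp : (P : A / R → Set p) → (∀ c → isProp (P c)) → (∀ x → P [ x ]) → ∀ c → P c
    quot-elimProp P P-prop f = quot-elim P (λ c → prop⇒set (P-prop c)) f λ _ → P-prop _ _ _

  -- The quotient of N by the image of φ.  Opaque definitions, here and
  -- below, keep the normal forms of groups and extensions small.
  module Coker {X N : AbGroup ℓ} (φ : Hom X N) where
    private
      module X = AbGroup X
      module N = AbGroup N
    open N using (_∙_; ε; _⁻¹)
    open ≡-Reasoning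

    _∼_ : Rel N.Carrier ℓ
    u ∼ v = ∥ (∃ λ x → ⟦ φ ⟧ x ≡ u ⁻¹ ∙ v) ∥

    private
      Q : Set ℓ
      Q = N.Carrier / _∼_

      ι : N.Carrier → Q
      ι = [_]

      interchange : ∀ a b c d → (a ∙ b) ∙ (c ∙ d) ≡ (a ∙ c) ∙ (b ∙ d)
      interchange a b c d = begin
        (a ∙ b) ∙ (c ∙ d) ≡⟨ N.assoc a b (c ∙ d) ⟩
        a ∙ (b ∙ (c ∙ d)) ≡⟨ cong (a ∙_) (N.assoc b c d) ⟨
        a ∙ ((b ∙ c) ∙ d) ≡⟨ cong (λ z → a ∙ (z ∙ d)) (N.comm b c) ⟩
        a ∙ ((c ∙ b) ∙ d) ≡⟨ cong (a ∙_) (N.assoc c b d) ⟩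
        a ∙ (c ∙ (b ∙ d)) ≡⟨ N.assoc a c (b ∙ d) ⟨
        (a ∙ c) ∙ (b ∙ d) ∎

    ∼-refl : ∀ {u} → u ∼ u
    ∼-refl = ∣ X.ε , trans (Hom.ε-homo φ) (sym (N.inverseˡ _)) ∣

    ∼-trans : ∀ {u v w} → u ∼ v → v ∼ w → u ∼ w
    ∼-trans {u} {v} {w} s t = trunc-rec squash (λ (x , e) → trunc-map (λ (y , d) → x X.∙ y , (begin
      ⟦ φ ⟧ (x X.∙ y)              ≡⟨ Hom.homo φ x y ⟩
      ⟦ φ ⟧ x ∙ ⟦ φ ⟧ y            ≡⟨ cong₂ _∙_ e d ⟩
      (u ⁻¹ ∙ v) ∙ (v ⁻¹ ∙ w)      ≡⟨ interchange _ _ _ _ ⟩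
      (u ⁻¹ ∙ v ⁻¹) ∙ (v ∙ w)      ≡⟨ cong ((u ⁻¹ ∙ v ⁻¹) ∙_) (N.comm v w) ⟩
      (u ⁻¹ ∙ v ⁻¹) ∙ (w ∙ v)      ≡⟨ interchange _ _ _ _ ⟩
      (u ⁻¹ ∙ w) ∙ (v ⁻¹ ∙ v)      ≡⟨ cong ((u ⁻¹ ∙ w) ∙_) (N.inverseˡ v) ⟩
      (u ⁻¹ ∙ w) ∙ ε               ≡⟨ N.identityʳ _ ⟩
      u ⁻¹ ∙ w                     ∎)) t) s

    ∼-∙ : ∀ {u u′ v v′} → u ∼ u′ → v ∼ v′ → (u ∙ v) ∼ (u′ ∙ v′)
    ∼-∙ {u} {u′} {v} {v′} s t = trunc-rec squash (λ (x , e) → trunc-map (λ (y , d) → x X.∙ y , (begin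
      ⟦ φ ⟧ (x X.∙ y)              ≡⟨ Hom.homo φ x y ⟩
      ⟦ φ ⟧ x ∙ ⟦ φ ⟧ y            ≡⟨ cong₂ _∙_ e d ⟩
      (u ⁻¹ ∙ u′) ∙ (v ⁻¹ ∙ v′)    ≡⟨ interchange _ _ _ _ ⟩
      (u ⁻¹ ∙ v ⁻¹) ∙ (u′ ∙ v′)    ≡⟨ cong (_∙ (u′ ∙ v′)) (N.⁻¹-∙-comm u v) ⟩
      (u ∙ v) ⁻¹ ∙ (u′ ∙ v′)       ∎)) t) s

    ∼-⁻¹ : ∀ {u v} → u ∼ v → (u ⁻¹) ∼ (v ⁻¹)
    ∼-⁻¹ {u} {v} = trunc-map λ (x , e) → x X.⁻¹ , (begin
      ⟦ φ ⟧ (x X.⁻¹)               ≡⟨ Hom.⁻¹-homo φ x ⟩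
      ⟦ φ ⟧ x ⁻¹                   ≡⟨ cong _⁻¹ e ⟩
      (u ⁻¹ ∙ v) ⁻¹                ≡⟨ N.⁻¹-∙-comm _ _ ⟨
      u ⁻¹ ⁻¹ ∙ v ⁻¹               ∎)

    opaque
      private
        ·ʳ-resp : ∀ u {v v′} → v ∼ v′ → ι (u ∙ v) ≡ ι (u ∙ v′)
        ·ʳ-resp u s = quot-eq (∼-∙ ∼-refl s)

        inv-resp : ∀ {u u′} → u ∼ u′ → ι (u ⁻¹) ≡ ι (u′ ⁻¹)
        inv-resp s = quot-eq (∼-⁻¹ s)

        ·ʳ : N.Carrier → Q → Q
        ·ʳ u = quot-rec quot-set (λ v → ι (u ∙ v)) (·ʳ-resp u)

        ·ʳ-β : ∀ u v → ·ʳ u (ι v) ≡ ι (u ∙ v)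
        ·ʳ-β u = quot-rec-β quot-set (λ v → ι (u ∙ v)) (·ʳ-resp u)

        ·ˡ-resp : ∀ d {u u′} → u ∼ u′ → ·ʳ u d ≡ ·ʳ u′ d
        ·ˡ-resp d {u} {u′} s = quot-elimProp (λ d → ·ʳ u d ≡ ·ʳ u′ d) (λ _ → quot-set) (λ v →
          trans (·ʳ-β _ v) (trans (quot-eq (∼-∙ s ∼-refl)) (sym (·ʳ-β _ v)))) d

      _·_ : Q → Q → Q
      c · d = quot-rec quot-set (λ u → ·ʳ u d) (·ˡ-resp d) c

      inv : Q → Q
      inv = quot-rec quot-set (λ u → ι (u ⁻¹)) inv-resp

      ·-β : ∀ u v → ι u · ι v ≡ ι (u ∙ v)
      ·-β u v = trans (quot-rec-β quot-set (λ u → ·ʳ u (ι v)) (·ˡ-resp (ι v)) u) (·ʳ-β u v)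

      inv-β : ∀ u → inv (ι u) ≡ ι (u ⁻¹)
      inv-β = quot-rec-β quot-set (λ u → ι (u ⁻¹)) inv-resp

      ·-assoc : ∀ c d e → (c · d) · e ≡ c · (d · e)
      ·-assoc c d e =
        quot-elimProp (λ c → (c · d) · e ≡ c · (d · e)) (λ _ → quot-set) (λ u →
        quot-elimProp (λ d → (ι u · d) · e ≡ ι u · (d · e)) (λ _ → quot-set) (λ v →
        quot-elimProp (λ e → (ι u · ι v) · e ≡ ι u · (ι v · e)) (λ _ → quot-set) (λ w → begin
          (ι u · ι v) · ι w   ≡⟨ cong (_· ι w) (·-β u v) ⟩
          ι (u ∙ v) · ι w     ≡⟨ ·-β _ _ ⟩
          ι ((u ∙ v) ∙ w)     ≡⟨ cong ι (N.assoc u v w) ⟩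
          ι (u ∙ (v ∙ w))     ≡⟨ ·-β _ _ ⟨
          ι u · ι (v ∙ w)     ≡⟨ cong (ι u ·_) (·-β v w) ⟨
          ι u · (ι v · ι w)   ∎) e) d) c

      ·-comm : ∀ c d → c · d ≡ d · c
      ·-comm c d =
        quot-elimProp (λ c → c · d ≡ d · c) (λ _ → quot-set) (λ u →
        quot-elimProp (λ d → ι u · d ≡ d · ι u) (λ _ → quot-set) (λ v →
          trans (·-β u v) (trans (cong ι (N.comm u v)) (sym (·-β v u)))) d) c

      Coker-isAbelianGroup : IsAbelianGroup _≡_ _·_ (ι ε) inv
      Coker-isAbelianGroup = ≡-isAbelianGroup ·-assoc ·-comm
        (quot-elimProp _ (λ _ → quot-set) λ u → trans (·-β ε u) (cong ι (N.identityˡ u)))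
        (quot-elimProp _ (λ _ → quot-set) λ u →
          trans (cong (_· ι u) (inv-β u)) (trans (·-β _ _) (cong ι (N.inverseˡ u))))

    Coker : AbGroup ℓ
    Coker = record
      { Carrier        = Q
      ; carrier-set    = quot-set
      ; _∙_            = _·_
      ; ε              = ι ε
      ; _⁻¹            = inv
      ; isAbelianGroup = Coker-isAbelianGroup
      }

    private
      opaque
        ι-∙ : ∀ u v → ι (u ∙ v) ≡ ι u · ι v
        ι-∙ u v = sym (·-β u v)

    coker-proj : Hom N Coker
    coker-proj = ∙-Hom ι ι-∙

    module _ {Z : AbGroup ℓ} (ψ : Hom N Z) (ψφ≡ε : ∀ x → ⟦ ψ ⟧ (⟦ φ ⟧ x) ≡ AbGroup.ε Z) where
      private
        module Z = AbGroup Z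

        opaque
          ψ-∼ : ∀ {u v} → u ∼ v → ⟦ ψ ⟧ u ≡ ⟦ ψ ⟧ v
          ψ-∼ {u} {v} = trunc-rec Z.carrier-set λ (x , e) → sym (Z.x∙y⁻¹≈ε⇒x≈y _ _ (begin
            ⟦ ψ ⟧ v Z.∙ ⟦ ψ ⟧ u Z.⁻¹     ≡⟨ Z.comm _ _ ⟩
            ⟦ ψ ⟧ u Z.⁻¹ Z.∙ ⟦ ψ ⟧ v     ≡⟨ cong (Z._∙ ⟦ ψ ⟧ v) (Hom.⁻¹-homo ψ u) ⟨
            ⟦ ψ ⟧ (u ⁻¹) Z.∙ ⟦ ψ ⟧ v     ≡⟨ Hom.homo ψ _ _ ⟨
            ⟦ ψ ⟧ (u ⁻¹ ∙ v)             ≡⟨ cong ⟦ ψ ⟧ e ⟨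
            ⟦ ψ ⟧ (⟦ φ ⟧ x)              ≡⟨ ψφ≡ε x ⟩
            Z.ε                          ∎))

      opaque
        rec-fun : Q → Z.Carrier
        rec-fun = quot-rec Z.carrier-set ⟦ ψ ⟧ ψ-∼

        coker-rec-β : ∀ u → rec-fun (ι u) ≡ ⟦ ψ ⟧ u
        coker-rec-β = quot-rec-β Z.carrier-set ⟦ ψ ⟧ ψ-∼

      private
        opaque
          rec-fun-∙ : ∀ c d → rec-fun (c · d) ≡ rec-fun c Z.∙ rec-fun d
          rec-fun-∙ c d =
            quot-elimProp (λ c → rec-fun (c · d) ≡ rec-fun c Z.∙ rec-fun d) (λ _ → Z.carrier-set) (λ u →
            quot-elimProp (λ d → rec-fun (ι u · d) ≡ rec-fun (ι u) Z.∙ rec-fun d) (λ _ → Z.carrier-set) (λ v → begin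
              rec-fun (ι u · ι v)                ≡⟨ cong rec-fun (·-β u v) ⟩
              rec-fun (ι (u ∙ v))                ≡⟨ coker-rec-β _ ⟩
              ⟦ ψ ⟧ (u ∙ v)                      ≡⟨ Hom.homo ψ u v ⟩
              ⟦ ψ ⟧ u Z.∙ ⟦ ψ ⟧ v                ≡⟨ cong₂ Z._∙_ (coker-rec-β u) (coker-rec-β v) ⟨
              rec-fun (ι u) Z.∙ rec-fun (ι v)    ∎) d) c

      coker-rec : Hom Coker Z
      coker-rec = ∙-Hom rec-fun rec-fun-∙

    module _ (ua : Univalence) where
      open UnivalenceProperties ua

      opaque
        coker-effective : ∀ {u v} → ι u ≡ ι v → u ∼ v
        coker-effective {u} {v} e = to-∼ (subst (λ c → proj₁ (code c)) e (from-∼ ∼-refl))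
          where
          ∼-sym : ∀ {w w′} → w ∼ w′ → w′ ∼ w
          ∼-sym {w} {w′} = trunc-map λ (x , d) → x X.⁻¹ , (begin
            ⟦ φ ⟧ (x X.⁻¹)        ≡⟨ Hom.⁻¹-homo φ x ⟩
            ⟦ φ ⟧ x ⁻¹            ≡⟨ cong _⁻¹ d ⟩
            (w ⁻¹ ∙ w′) ⁻¹        ≡⟨ N.inverseˡ-unique _ _ (begin
              (w′ ⁻¹ ∙ w) ∙ (w ⁻¹ ∙ w′)    ≡⟨ cong ((w′ ⁻¹ ∙ w) ∙_) (N.comm _ _) ⟩
              (w′ ⁻¹ ∙ w) ∙ (w′ ∙ w ⁻¹)    ≡⟨ interchange _ _ _ _ ⟩
              (w′ ⁻¹ ∙ w′) ∙ (w ∙ w ⁻¹)    ≡⟨ cong₂ _∙_ (N.inverseˡ _) (N.inverseʳ _) ⟩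
              ε ∙ ε                        ≡⟨ N.identityˡ _ ⟩
              ε                            ∎) ⟨
            w′ ⁻¹ ∙ w             ∎)

          code-∼ : ∀ {w w′} → w ∼ w′ → _≡_ {A = hProp ℓ} (u ∼ w , squash) (u ∼ w′ , squash)
          code-∼ s = hProp-≡ (λ t → ∼-trans t s) (λ t → ∼-trans t (∼-sym s))

          code : Q → hProp ℓ
          code = quot-rec hProp-set (λ w → (u ∼ w) , squash) code-∼

          code-β : ∀ w → code (ι w) ≡ ((u ∼ w) , squash)
          code-β = quot-rec-β hProp-set (λ w → (u ∼ w) , squash) code-∼

          to-∼ : ∀ {w} → proj₁ (code (ι w)) → u ∼ w
          to-∼ {w} = subst proj₁ (code-β w)

          from-∼ : ∀ {w} → u ∼ w → proj₁ (code (ι w))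
          from-∼ {w} = subst proj₁ (sym (code-β w))

record PointedSet (a : Level) : Set (lsuc a) where
  field
    ⟨_⟩     : Set a
    ⟨⟩-set  : isSet ⟨_⟩
    point   : ⟨_⟩

open PointedSet using (⟨_⟩; point)

infix 4 _→∙_

_→∙_ : PointedSet a → PointedSet b → Set (a ⊔ b)
S →∙ T = Σ (⟨ S ⟩ → ⟨ T ⟩) λ u → u (point S) ≡ point T

module Yoneda (ua : Univalence) (hits : HITs) where
  open HITs hits
  open UnivalenceProperties ua
  open HITProperties hits

  IsExactAt : (T : PointedSet a) {S : PointedSet b} {U : PointedSet p} → S →∙ T → T →∙ U → Set (a ⊔ b ⊔ p)
  IsExactAt T {S} {U} (u , _) (v , _) = ∀ t → ∥ (∃ λ s → u s ≡ t) ∥ ⇔ v t ≡ point U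

  record IsSES {X M Y : AbGroup ℓ} (j : Hom X M) (q : Hom M Y) : Set ℓ where
    field
      injective  : Injective _≡_ _≡_ ⟦ j ⟧
      surjective : ∀ y → ∥ (∃ λ m → ⟦ q ⟧ m ≡ y) ∥
      complex    : ∀ x → ⟦ q ⟧ (⟦ j ⟧ x) ≡ AbGroup.ε Y
      exact      : ∀ m → ⟦ q ⟧ m ≡ AbGroup.ε Y → ∥ (∃ λ x → ⟦ j ⟧ x ≡ m) ∥

  record AbSES (Y X : AbGroup ℓ) : Set (lsuc ℓ) where
    no-eta-equality; pattern
    constructor mkAbSES
    field
      mid   : AbGroup ℓ
      incl  : Hom X mid
      proj  : Hom mid Y
      isSES : IsSES incl proj

    open IsSES isSES public

  open AbSES using (mid; incl; proj)

  opaque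
    isSES-prop : {X M Y : AbGroup ℓ} {j : Hom X M} {q : Hom M Y} → isProp (IsSES j q)
    isSES-prop {X = X} {Y = Y} = retract-prop
      (λ s → let open IsSES s in (λ x y → injective {x} {y}) , surjective , complex , exact)
      (λ (i , s , c , e) → record { injective = i _ _ ; surjective = s ; complex = c ; exact = e })
      (λ _ → refl)
      (×-prop (Π-prop λ _ → Π-prop λ _ → Π-prop λ _ → carrier-set X)
      (×-prop (Π-prop λ _ → squash)
      (×-prop (Π-prop λ _ → carrier-set Y) (Π-prop λ _ → Π-prop λ _ → squash))))

  opaque
    -- By the short five lemma and univalence, a morphism that is the
    -- identity on both ends gives a path.
    abSES-path : {Y X : AbGroup ℓ} {E E′ : AbSES Y X} (φ : Hom (mid E) (mid E′)) →
                 (∀ x → ⟦ φ ⟧ (⟦ incl E ⟧ x) ≡ ⟦ incl E′ ⟧ x) →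
                 (∀ m → ⟦ proj E′ ⟧ (⟦ φ ⟧ m) ≡ ⟦ proj E ⟧ m) → E ≡ E′
    abSES-path {Y = Y} {X} {E@(mkAbSES _ _ _ _)} {E′@(mkAbSES _ _ _ _)} φ φ-incl φ-proj =
      let e , e≡φ = abGroup-path φ φ-equiv
      in along e (incl E′) (proj E′) (AbSES.isSES E′)
           (λ x → trans (e≡φ _) (φ-incl x))
           (λ m → trans (cong ⟦ proj E′ ⟧ (e≡φ m)) (φ-proj m))
      where
      module X  = AbGroup X
      module Y  = AbGroup Y
      module M  = AbGroup (mid E)
      module M′ = AbGroup (mid E′)
      module E  = AbSES E
      module E′ = AbSES E′
      open ≡-Reasoning

      φ-kernel : ∀ m → ⟦ φ ⟧ m ≡ M′.ε → m ≡ M.ε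
      φ-kernel m φm≡ε = trunc-rec M.carrier-set
        (λ (x , jx≡m) → begin
          m              ≡⟨ jx≡m ⟨
          ⟦ E.incl ⟧ x   ≡⟨ cong ⟦ E.incl ⟧ (E′.injective (begin
            ⟦ E′.incl ⟧ x            ≡⟨ φ-incl x ⟨
            ⟦ φ ⟧ (⟦ E.incl ⟧ x)     ≡⟨ cong ⟦ φ ⟧ jx≡m ⟩
            ⟦ φ ⟧ m                  ≡⟨ φm≡ε ⟩
            M′.ε                     ≡⟨ Hom.ε-homo E′.incl ⟨
            ⟦ E′.incl ⟧ X.ε          ∎)) ⟩
          ⟦ E.incl ⟧ X.ε ≡⟨ Hom.ε-homo E.incl ⟩
          M.ε            ∎)
        (E.exact m (begin
          ⟦ E.proj ⟧ m             ≡⟨ φ-proj m ⟨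
          ⟦ E′.proj ⟧ (⟦ φ ⟧ m)    ≡⟨ cong ⟦ E′.proj ⟧ φm≡ε ⟩
          ⟦ E′.proj ⟧ M′.ε         ≡⟨ Hom.ε-homo E′.proj ⟩
          Y.ε                      ∎))

      φ-injective : ∀ {m m′} → ⟦ φ ⟧ m ≡ ⟦ φ ⟧ m′ → m ≡ m′
      φ-injective {m} {m′} d = M.x∙y⁻¹≈ε⇒x≈y _ _ (φ-kernel _ (begin
        ⟦ φ ⟧ (m M.∙ m′ M.⁻¹)            ≡⟨ Hom.homo φ _ _ ⟩
        ⟦ φ ⟧ m M′.∙ ⟦ φ ⟧ (m′ M.⁻¹)     ≡⟨ cong₂ M′._∙_ d (Hom.⁻¹-homo φ m′) ⟩
        ⟦ φ ⟧ m′ M′.∙ ⟦ φ ⟧ m′ M′.⁻¹     ≡⟨ M′.inverseʳ _ ⟩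
        M′.ε                             ∎))

      φ-surjective : ∀ m′ → ∥ fiber ⟦ φ ⟧ m′ ∥
      φ-surjective m′ = trunc-rec squash (λ (m , qm≡) → trunc-map
        (λ (x , j′x≡) → ⟦ E.incl ⟧ x M.∙ m , (begin
          ⟦ φ ⟧ (⟦ E.incl ⟧ x M.∙ m)               ≡⟨ Hom.homo φ _ _ ⟩
          ⟦ φ ⟧ (⟦ E.incl ⟧ x) M′.∙ ⟦ φ ⟧ m        ≡⟨ cong (M′._∙ ⟦ φ ⟧ m) (trans (φ-incl x) j′x≡) ⟩
          m′ M′.∙ ⟦ φ ⟧ m M′.⁻¹ M′.∙ ⟦ φ ⟧ m       ≡⟨ M′.assoc _ _ _ ⟩
          m′ M′.∙ (⟦ φ ⟧ m M′.⁻¹ M′.∙ ⟦ φ ⟧ m)     ≡⟨ cong (m′ M′.∙_) (M′.inverseˡ _) ⟩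
          m′ M′.∙ M′.ε                             ≡⟨ M′.identityʳ _ ⟩
          m′                                       ∎))
        (E′.exact (m′ M′.∙ ⟦ φ ⟧ m M′.⁻¹) (begin
          ⟦ E′.proj ⟧ (m′ M′.∙ ⟦ φ ⟧ m M′.⁻¹)               ≡⟨ Hom.homo E′.proj _ _ ⟩
          ⟦ E′.proj ⟧ m′ Y.∙ ⟦ E′.proj ⟧ (⟦ φ ⟧ m M′.⁻¹)    ≡⟨ cong₂ Y._∙_ (sym qm≡) (Hom.⁻¹-homo E′.proj _) ⟩
          ⟦ E.proj ⟧ m Y.∙ ⟦ E′.proj ⟧ (⟦ φ ⟧ m) Y.⁻¹       ≡⟨ cong (λ y → ⟦ E.proj ⟧ m Y.∙ y Y.⁻¹) (φ-proj m) ⟩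
          ⟦ E.proj ⟧ m Y.∙ ⟦ E.proj ⟧ m Y.⁻¹                ≡⟨ Y.inverseʳ _ ⟩
          Y.ε                                               ∎)))
        (E.surjective (⟦ E′.proj ⟧ m′))

      φ-equiv : isEquiv ⟦ φ ⟧
      φ-equiv m′ = trunc-rec fiber-prop id (φ-surjective m′) , fiber-prop _
        where
        fiber-prop : isProp (fiber ⟦ φ ⟧ m′)
        fiber-prop (_ , d) (_ , e) = Σ-prop-≡ (λ _ → M′.carrier-set) (φ-injective (trans d (sym e)))

      along : {M′ : AbGroup _} (e : mid E ≡ M′) (j′ : Hom X M′) (q′ : Hom M′ Y) (ses : IsSES j′ q′) →
              (∀ x → subst Carrier e (⟦ E.incl ⟧ x) ≡ ⟦ j′ ⟧ x) →
              (∀ m → ⟦ q′ ⟧ (subst Carrier e m) ≡ ⟦ E.proj ⟧ m) →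
              E ≡ mkAbSES M′ j′ q′ ses
      along refl j′ q′ ses e-incl e-proj
        with hom-≡ {f = E.incl} {j′} e-incl | hom-≡ {f = E.proj} {q′} (λ m → sym (e-proj m))
      ... | refl | refl = cong (mkAbSES _ _ _) (isSES-prop _ _)

  trivialSES : {Y X : AbGroup ℓ} → AbSES Y X
  trivialSES {Y = Y} {X} = record
    { mid   = X ⊕ Y
    ; incl  = inˡ
    ; proj  = outʳ
    ; isSES = record
      { injective  = cong proj₁
      ; surjective = λ y → ∣ (X.ε , y) , refl ∣
      ; complex    = λ _ → refl
      ; exact      = λ (x , y) y≡ε → ∣ x , cong (x ,_) (sym y≡ε) ∣
      }
    }
    where
    module X = AbGroup X
    module Y = AbGroup Y

  module _ {Y Y′ X : AbGroup ℓ} (g : Hom Y′ Y) (E : AbSES Y X) where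
    private
      module Y′ = AbGroup Y′
      module E  = AbSES E
      module P  = AbGroup (Pullback E.proj g)

      opaque
        incl-agree : ∀ x → ⟦ E.proj ⟧ (⟦ E.incl ⟧ x) ≡ ⟦ g ⟧ Y′.ε
        incl-agree x = trans (E.complex x) (sym (Hom.ε-homo g))

      incl′ : Carrier X → P.Carrier
      incl′ x = (⟦ E.incl ⟧ x , Y′.ε) , incl-agree x

      opaque
        incl′-∙ : ∀ x x′ → incl′ (AbGroup._∙_ X x x′) ≡ incl′ x P.∙ incl′ x′
        incl′-∙ x x′ = pullback-≡ E.proj g (Hom.homo E.incl x x′) (sym (Y′.identityˡ _))

      pull-incl : Hom X (Pullback E.proj g)
      pull-incl = ∙-Hom incl′ incl′-∙

      pull-proj : Hom (Pullback E.proj g) Y′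
      pull-proj = ∙-Hom (λ ((_ , y) , _) → y) λ _ _ → refl

    opaque
      pull-isSES : IsSES pull-incl pull-proj
      pull-isSES = record
        { injective  = λ e → E.injective (cong (proj₁ ∘ proj₁) e)
        ; surjective = λ y → trunc-map (λ (m , e) → ((m , y) , e) , refl) (E.surjective (⟦ g ⟧ y))
        ; complex    = λ _ → refl
        ; exact      = λ ((m , y) , e) y≡ε → trunc-map
            (λ (x , jx≡m) → x , pullback-≡ E.proj g jx≡m (sym y≡ε))
            (E.exact m (trans e (trans (cong ⟦ g ⟧ y≡ε) (Hom.ε-homo g))))
        }

    pullSES : AbSES Y′ X
    pullSES = mkAbSES (Pullback E.proj g) pull-incl pull-proj pull-isSES

  module _ {Y X X′ : AbGroup ℓ} (f : Hom X X′) (E : AbSES Y X) where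
    private
      module X  = AbGroup X
      module X′ = AbGroup X′
      module Y  = AbGroup Y
      module M  = AbGroup (mid E)
      module E  = AbSES E
    open ≡-Reasoning

    private
      opaque
        antidiagonal-∙ : ∀ x x′ →
          _≡_ {A = X′.Carrier × M.Carrier}
            (⟦ f ⟧ (x X.∙ x′) , ⟦ E.incl ⟧ (x X.∙ x′) M.⁻¹)
            (⟦ f ⟧ x X′.∙ ⟦ f ⟧ x′ , ⟦ E.incl ⟧ x M.⁻¹ M.∙ ⟦ E.incl ⟧ x′ M.⁻¹)
        antidiagonal-∙ x x′ = cong₂ _,_ (Hom.homo f x x′)
          (trans (cong M._⁻¹ (Hom.homo E.incl x x′)) (sym (M.⁻¹-∙-comm _ _)))

    antidiagonal : Hom X (X′ ⊕ mid E)
    antidiagonal = ∙-Hom (λ x → ⟦ f ⟧ x , ⟦ E.incl ⟧ x M.⁻¹) antidiagonal-∙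

    open Coker antidiagonal

    proj∘outʳ : Hom (X′ ⊕ mid E) Y
    proj∘outʳ = E.proj ∘ₕ outʳ

    opaque
      proj∘outʳ-kills : ∀ x → ⟦ E.proj ⟧ (⟦ E.incl ⟧ x M.⁻¹) ≡ Y.ε
      proj∘outʳ-kills x = begin
        ⟦ E.proj ⟧ (⟦ E.incl ⟧ x M.⁻¹)    ≡⟨ Hom.⁻¹-homo E.proj _ ⟩
        ⟦ E.proj ⟧ (⟦ E.incl ⟧ x) Y.⁻¹    ≡⟨ cong Y._⁻¹ (E.complex x) ⟩
        Y.ε Y.⁻¹                          ≡⟨ Y.ε⁻¹≈ε ⟩
        Y.ε                               ∎

    private
      push-incl : Hom X′ Coker
      push-incl = coker-proj ∘ₕ inˡ

      push-proj : Hom Coker Y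
      push-proj = coker-rec proj∘outʳ proj∘outʳ-kills

    opaque
      push-isSES : IsSES push-incl push-proj
      push-isSES = record
        { injective  = λ {x} {x′} e → trunc-rec X′.carrier-set (λ (z , d) → sym (X′.x∙y⁻¹≈ε⇒x≈y _ _ (begin
            x′ X′.∙ x X′.⁻¹   ≡⟨ X′.comm _ _ ⟩
            x X′.⁻¹ X′.∙ x′   ≡⟨ cong proj₁ d ⟨
            ⟦ f ⟧ z           ≡⟨ cong ⟦ f ⟧ (E.injective (begin
              ⟦ E.incl ⟧ z        ≡⟨ M.x∙y⁻¹≈ε⇒x≈y _ _ (begin
                ⟦ E.incl ⟧ z M.∙ M.ε M.⁻¹           ≡⟨ cong (⟦ E.incl ⟧ z M.∙_)
                                                         (trans M.ε⁻¹≈ε (sym (trans (cong proj₂ d) (M.inverseˡ M.ε)))) ⟩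
                ⟦ E.incl ⟧ z M.∙ ⟦ E.incl ⟧ z M.⁻¹  ≡⟨ M.inverseʳ _ ⟩
                M.ε                                 ∎) ⟩
              M.ε                 ≡⟨ Hom.ε-homo E.incl ⟨
              ⟦ E.incl ⟧ X.ε      ∎)) ⟩
            ⟦ f ⟧ X.ε         ≡⟨ Hom.ε-homo f ⟩
            X′.ε              ∎))) (coker-effective ua e)
        ; surjective = λ y → trunc-map
            (λ (m , e) → [ X′.ε , m ] , trans (coker-rec-β proj∘outʳ proj∘outʳ-kills _) e) (E.surjective y)
        ; complex    = λ x → trans (coker-rec-β proj∘outʳ proj∘outʳ-kills _) (Hom.ε-homo E.proj)
        ; exact      = quot-elimProp _ (λ _ → Π-prop λ _ → squash) λ (x′ , m) e → trunc-map
            (λ (x , jx≡m) → x′ X′.∙ ⟦ f ⟧ x , quot-eq ∣ x X.⁻¹ , cong₂ _,_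
              (begin
                ⟦ f ⟧ (x X.⁻¹)                              ≡⟨ Hom.⁻¹-homo f x ⟩
                ⟦ f ⟧ x X′.⁻¹                               ≡⟨ X′.identityˡ _ ⟨
                X′.ε X′.∙ ⟦ f ⟧ x X′.⁻¹                     ≡⟨ cong (X′._∙ ⟦ f ⟧ x X′.⁻¹) (X′.inverseʳ x′) ⟨
                x′ X′.∙ x′ X′.⁻¹ X′.∙ ⟦ f ⟧ x X′.⁻¹         ≡⟨ X′.assoc _ _ _ ⟩
                x′ X′.∙ (x′ X′.⁻¹ X′.∙ ⟦ f ⟧ x X′.⁻¹)       ≡⟨ X′.comm _ _ ⟩
                x′ X′.⁻¹ X′.∙ ⟦ f ⟧ x X′.⁻¹ X′.∙ x′         ≡⟨ cong (X′._∙ x′) (X′.⁻¹-∙-comm _ _) ⟩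
                (x′ X′.∙ ⟦ f ⟧ x) X′.⁻¹ X′.∙ x′             ∎)
              (begin
                ⟦ E.incl ⟧ (x X.⁻¹) M.⁻¹            ≡⟨ M.inverseˡ-unique _ _ (begin
                  m M.∙ ⟦ E.incl ⟧ (x X.⁻¹)             ≡⟨ cong (M._∙ _) jx≡m ⟨
                  ⟦ E.incl ⟧ x M.∙ ⟦ E.incl ⟧ (x X.⁻¹)  ≡⟨ Hom.homo E.incl _ _ ⟨
                  ⟦ E.incl ⟧ (x X.∙ x X.⁻¹)             ≡⟨ cong ⟦ E.incl ⟧ (X.inverseʳ x) ⟩
                  ⟦ E.incl ⟧ X.ε                        ≡⟨ Hom.ε-homo E.incl ⟩
                  M.ε                                   ∎) ⟨
                m                                   ≡⟨ M.identityˡ m ⟨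
                M.ε M.∙ m                           ≡⟨ cong (M._∙ m) M.ε⁻¹≈ε ⟨
                M.ε M.⁻¹ M.∙ m                      ∎) ∣)
            (E.exact m (trans (sym (coker-rec-β proj∘outʳ proj∘outʳ-kills _)) e))
        }

    pushSES : AbSES Y X′
    pushSES = mkAbSES Coker push-incl push-proj push-isSES

    opaque
      pushSES-path : {E′ : AbSES Y X′} (φ : Hom (mid E) (mid E′)) →
                     (∀ x → ⟦ φ ⟧ (⟦ E.incl ⟧ x) ≡ ⟦ incl E′ ⟧ (⟦ f ⟧ x)) →
                     (∀ m → ⟦ proj E′ ⟧ (⟦ φ ⟧ m) ≡ ⟦ E.proj ⟧ m) → pushSES ≡ E′
      pushSES-path {E′} φ φ-incl φ-proj = abSES-path (coker-rec ψ ψ-kills)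
        (λ x → trans (coker-rec-β ψ ψ-kills _)
          (trans (cong (⟦ E′.incl ⟧ x M′.∙_) (Hom.ε-homo φ)) (M′.identityʳ _)))
        (quot-elimProp _ (λ _ → Y.carrier-set) λ (x , m) → begin
          ⟦ E′.proj ⟧ (⟦ coker-rec ψ ψ-kills ⟧ [ x , m ])          ≡⟨ cong ⟦ E′.proj ⟧ (coker-rec-β ψ ψ-kills _) ⟩
          ⟦ E′.proj ⟧ (⟦ E′.incl ⟧ x M′.∙ ⟦ φ ⟧ m)                 ≡⟨ Hom.homo E′.proj _ _ ⟩
          ⟦ E′.proj ⟧ (⟦ E′.incl ⟧ x) Y.∙ ⟦ E′.proj ⟧ (⟦ φ ⟧ m)    ≡⟨ cong₂ Y._∙_ (E′.complex x) (φ-proj m) ⟩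
          Y.ε Y.∙ ⟦ E.proj ⟧ m                                     ≡⟨ Y.identityˡ _ ⟩
          ⟦ E.proj ⟧ m                                             ≡⟨ coker-rec-β proj∘outʳ proj∘outʳ-kills _ ⟨
          ⟦ proj pushSES ⟧ [ x , m ]                               ∎)
        where
        module M′ = AbGroup (mid E′)
        module E′ = AbSES E′

        ψ : Hom (X′ ⊕ mid E) (mid E′)
        ψ = ∙-Hom (λ (x , m) → ⟦ E′.incl ⟧ x M′.∙ ⟦ φ ⟧ m) λ (x , m) (x′ , m′) → begin
          ⟦ E′.incl ⟧ (x X′.∙ x′) M′.∙ ⟦ φ ⟧ (m M.∙ m′)
            ≡⟨ cong₂ M′._∙_ (Hom.homo E′.incl x x′) (Hom.homo φ m m′) ⟩
          (⟦ E′.incl ⟧ x M′.∙ ⟦ E′.incl ⟧ x′) M′.∙ (⟦ φ ⟧ m M′.∙ ⟦ φ ⟧ m′)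
            ≡⟨ M′.assoc _ _ _ ⟩
          ⟦ E′.incl ⟧ x M′.∙ (⟦ E′.incl ⟧ x′ M′.∙ (⟦ φ ⟧ m M′.∙ ⟦ φ ⟧ m′))
            ≡⟨ cong (⟦ E′.incl ⟧ x M′.∙_) (M′.assoc _ _ _) ⟨
          ⟦ E′.incl ⟧ x M′.∙ (⟦ E′.incl ⟧ x′ M′.∙ ⟦ φ ⟧ m M′.∙ ⟦ φ ⟧ m′)
            ≡⟨ cong (λ z → ⟦ E′.incl ⟧ x M′.∙ (z M′.∙ ⟦ φ ⟧ m′)) (M′.comm _ _) ⟩
          ⟦ E′.incl ⟧ x M′.∙ (⟦ φ ⟧ m M′.∙ ⟦ E′.incl ⟧ x′ M′.∙ ⟦ φ ⟧ m′)
            ≡⟨ cong (⟦ E′.incl ⟧ x M′.∙_) (M′.assoc _ _ _) ⟩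
          ⟦ E′.incl ⟧ x M′.∙ (⟦ φ ⟧ m M′.∙ (⟦ E′.incl ⟧ x′ M′.∙ ⟦ φ ⟧ m′))
            ≡⟨ M′.assoc _ _ _ ⟨
          (⟦ E′.incl ⟧ x M′.∙ ⟦ φ ⟧ m) M′.∙ (⟦ E′.incl ⟧ x′ M′.∙ ⟦ φ ⟧ m′)
            ∎

        ψ-kills : ∀ x → ⟦ E′.incl ⟧ (⟦ f ⟧ x) M′.∙ ⟦ φ ⟧ (⟦ E.incl ⟧ x M.⁻¹) ≡ M′.ε
        ψ-kills x = begin
          ⟦ E′.incl ⟧ (⟦ f ⟧ x) M′.∙ ⟦ φ ⟧ (⟦ E.incl ⟧ x M.⁻¹)
            ≡⟨ cong₂ M′._∙_ (sym (φ-incl x)) (Hom.⁻¹-homo φ _) ⟩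
          ⟦ φ ⟧ (⟦ E.incl ⟧ x) M′.∙ ⟦ φ ⟧ (⟦ E.incl ⟧ x) M′.⁻¹
            ≡⟨ M′.inverseʳ _ ⟩
          M′.ε
            ∎

  opaque
    pullSES-path : {Y Y′ X : AbGroup ℓ} (g : Hom Y′ Y) (E : AbSES Y X) {E′ : AbSES Y′ X}
                   (φ : Hom (mid E′) (mid E)) →
                   (∀ x → ⟦ φ ⟧ (⟦ incl E′ ⟧ x) ≡ ⟦ incl E ⟧ x) →
                   (∀ m → ⟦ proj E ⟧ (⟦ φ ⟧ m) ≡ ⟦ g ⟧ (⟦ proj E′ ⟧ m)) → E′ ≡ pullSES g E
    pullSES-path g E {E′} φ φ-incl φ-proj = abSES-path
      (∙-Hom (λ m → (⟦ φ ⟧ m , ⟦ proj E′ ⟧ m) , φ-proj m)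
        λ m m′ → pullback-≡ (proj E) g (Hom.homo φ m m′) (Hom.homo (proj E′) m m′))
      (λ x → pullback-≡ (proj E) g (φ-incl x) (AbSES.complex E′ x))
      (λ _ → refl)

  opaque
    pull-push : {Y Y′ X X′ : AbGroup ℓ} (g : Hom Y′ Y) (f : Hom X X′) (E : AbSES Y X) →
                pushSES f (pullSES g E) ≡ pullSES g (pushSES f E)
    pull-push {X′ = X′} g f E = pushSES-path f (pullSES g E)
      (∙-Hom
        (λ ((m , y) , e) → (⟦ ι ⟧ m , y) , trans (ι-proj m) e)
        λ _ _ → pullback-≡ (proj (pushSES f E)) g (Hom.homo ι _ _) refl)
      (λ x → pullback-≡ (proj (pushSES f E)) g (ι-incl x) refl)
      (λ _ → refl)
      where
      module X′ = AbGroup X′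
      module M  = AbGroup (mid E)
      open Coker (antidiagonal f E)

      ι : Hom (mid E) Coker
      ι = coker-proj ∘ₕ inʳ

      ι-proj : ∀ m → ⟦ proj (pushSES f E) ⟧ (⟦ ι ⟧ m) ≡ ⟦ proj E ⟧ m
      ι-proj m = coker-rec-β (proj∘outʳ f E) (proj∘outʳ-kills f E) (X′.ε , m)

      ι-incl : ∀ x → ⟦ ι ⟧ (⟦ incl E ⟧ x) ≡ ⟦ incl (pushSES f E) ⟧ (⟦ f ⟧ x)
      ι-incl x = quot-eq ∣ x , cong₂ _,_
        (sym (trans (cong (X′._∙ _) X′.ε⁻¹≈ε) (X′.identityˡ _))) (sym (M.identityʳ _)) ∣

  ES : ℕ → AbGroup ℓ → AbGroup ℓ → Set (lsuc ℓ)
  ES {ℓ} zero          Y X = Lift (lsuc ℓ) (Hom Y X)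
  ES     (suc zero)    Y X = AbSES Y X
  ES {ℓ} (suc (suc n)) Y X = Σ (AbGroup ℓ) λ M → ES (suc n) M X × AbSES Y M

  ptES : ∀ n {Y X : AbGroup ℓ} → ES n Y X
  ptES zero          = lift zeroHom
  ptES (suc zero)    = trivialSES
  ptES (suc (suc n)) = 𝟘 , ptES (suc n) , trivialSES

  pull : ∀ n {Y Y′ X : AbGroup ℓ} → Hom Y′ Y → ES n Y X → ES n Y′ X
  pull zero          g (lift f)    = lift (f ∘ₕ g)
  pull (suc zero)    g E           = pullSES g E
  pull (suc (suc n)) g (M , F , E) = M , F , pullSES g E

  splice : ∀ n {X Y Z : AbGroup ℓ} → ES (suc n) Y X → AbSES Z Y → ES (suc (suc n)) Z X
  splice n {Y = Y} F E = Y , F , E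

  Zig : ∀ n {Y X : AbGroup ℓ} → Rel (ES n Y X) (lsuc ℓ)
  Zig zero          F F′ = F ≡ F′
  Zig (suc zero)    F F′ = F ≡ F′
  Zig (suc (suc n)) (M , F , E′) (N , F′ , E″) =
    Σ (Hom M N) λ h → pushSES h E′ ≡ E″ × Zig (suc n) F (pull (suc n) h F′)

  pushSES-id : {Y X : AbGroup ℓ} (E : AbSES Y X) → pushSES idHom E ≡ E
  pushSES-id E = pushSES-path idHom E idHom (λ _ → refl) (λ _ → refl)

  pullSES-id : {Y X : AbGroup ℓ} (E : AbSES Y X) → pullSES idHom E ≡ E
  pullSES-id E = sym (pullSES-path idHom E idHom (λ _ → refl) (λ _ → refl))

  pull-id : ∀ n {Y X : AbGroup ℓ} (F : ES n Y X) → pull n idHom F ≡ F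
  pull-id zero          (lift f)    = cong lift (hom-≡ λ _ → refl)
  pull-id (suc zero)    E           = pullSES-id E
  pull-id (suc (suc n)) (M , F , E) = cong (λ D → M , F , D) (pullSES-id E)

  pull-pt : ∀ n {Y Y′ X : AbGroup ℓ} (g : Hom Y′ Y) → pull n {X = X} g (ptES n) ≡ ptES n
  pull-pt zero          g = cong lift (hom-≡ λ _ → refl)
  pull-pt (suc zero)    g = sym (pullSES-path g trivialSES
    (∙-Hom (λ (x , y) → x , ⟦ g ⟧ y) λ _ _ → cong (_ ,_) (Hom.homo g _ _))
    (λ x → cong (x ,_) (Hom.ε-homo g)) (λ _ → refl))
  pull-pt (suc (suc n)) g = cong (λ D → 𝟘 , ptES (suc n) , D) (pull-pt 1 g)

  zig-refl : ∀ n {Y X : AbGroup ℓ} {F F′ : ES n Y X} → F ≡ F′ → Zig n F F′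
  zig-refl zero          e = e
  zig-refl (suc zero)    e = e
  zig-refl (suc (suc n)) {F = _ , F , E} refl =
    idHom , pushSES-id E , zig-refl (suc n) (sym (pull-id (suc n) F))

  zig-pull : ∀ n {Y Y′ X : AbGroup ℓ} (g : Hom Y′ Y) {F F′ : ES n Y X} →
             Zig n F F′ → Zig n (pull n g F) (pull n g F′)
  zig-pull zero          g e           = cong (pull 0 g) e
  zig-pull (suc zero)    g e           = cong (pullSES g) e
  zig-pull (suc (suc n)) g {_ , _ , E} {_ , _ , E″} (h , e , z) = h , path , z
    where
    path : pushSES h (pullSES g E) ≡ pullSES g E″
    path = trans (pull-push g h E) (cong (pullSES g) e)

  zig-splice : ∀ n {X Y Z : AbGroup ℓ} (E : AbSES Z Y) {F F′ : ES (suc n) Y X} →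
               Zig (suc n) F F′ → Zig (suc (suc n)) (splice n F E) (splice n F′ E)
  zig-splice n E {F} {F′} z = idHom , pushSES-id E , subst (Zig (suc n) F) (sym (pull-id (suc n) F′)) z

  zig-splice-pt : ∀ n {X Y Z : AbGroup ℓ} (E : AbSES Z Y) →
                  Zig (suc (suc n)) {X = X} (splice n (ptES (suc n)) E) (ptES (suc (suc n)))
  zig-splice-pt n E =
    zeroHom ,
    pushSES-path zeroHom E (∙-Hom (λ m → tt , ⟦ proj E ⟧ m) λ _ _ → cong (tt ,_) (Hom.homo (proj E) _ _))
      (λ x → cong (tt ,_) (AbSES.complex E x)) (λ _ → refl) ,
    zig-refl (suc n) (sym (pull-pt (suc n) zeroHom))

  infix 4 _≈ES_

  _≈ES_ : ∀ {n} {Y X : AbGroup ℓ} → Rel (ES n Y X) (lsuc ℓ)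
  _≈ES_ {n = n} F F′ = ∥ EqClosure (Zig n) F F′ ∥

  Ext : ℕ → AbGroup ℓ → AbGroup ℓ → PointedSet (lsuc ℓ)
  Ext n Y X = record
    { ⟨_⟩    = ES n Y X / _≈ES_ {n = n}
    ; ⟨⟩-set = quot-set
    ; point  = [ ptES n ]
    }

  zig-eq : ∀ n {Y X : AbGroup ℓ} {F F′ : ES n Y X} → Zig n F F′ → _≡_ {A = ⟨ Ext n Y X ⟩} [ F ] [ F′ ]
  zig-eq n z = quot-eq ∣ return⋆ (fwd z) ∣

  module _ {m n : ℕ} {Y X Y′ X′ : AbGroup ℓ} (u : ES m Y X → ES n Y′ X′)
           (u-zig : ∀ {F F′} → Zig m F F′ → Zig n (u F) (u F′)) where
    private
      u-≈ : ∀ {F F′} → _≈ES_ {n = m} F F′ → _≡_ {A = ⟨ Ext n Y′ X′ ⟩} [ u F ] [ u F′ ]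
      u-≈ = quot-eq ∘ trunc-map (EqC.gmap u u-zig)

    Ext-map : ⟨ Ext m Y X ⟩ → ⟨ Ext n Y′ X′ ⟩
    Ext-map = quot-rec quot-set (λ F → [ u F ]) u-≈

    Ext-map-β : ∀ F → Ext-map [ F ] ≡ [ u F ]
    Ext-map-β = quot-rec-β quot-set (λ F → [ u F ]) u-≈

  infix 9 _⋆

  _⋆ : ∀ {n} {Y Y′ X : AbGroup ℓ} → Hom Y′ Y → Ext n Y X →∙ Ext n Y′ X
  _⋆ {n = n} g =
    Ext-map {m = n} {n = n} (pull n g) (zig-pull n g) ,
    trans (Ext-map-β {m = n} {n = n} (pull n g) (zig-pull n g) _) (cong [_] (pull-pt n g))

  ▷_ : ∀ {n} {X Y Z : AbGroup ℓ} → AbSES Z Y → Ext (suc n) Y X →∙ Ext (suc (suc n)) Z X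
  ▷_ {n = n} E =
    Ext-map {m = suc n} {n = suc (suc n)} (λ F → splice n F E) (zig-splice n E) ,
    trans (Ext-map-β {m = suc n} {n = suc (suc n)} (λ F → splice n F E) (zig-splice n E) _)
          (zig-eq (suc (suc n)) (zig-splice-pt n E))

{-# OPTIONS --safe #-}
{-# OPTIONS --without-K #-}
module Submission where

open import Level using (Level; lift) renaming (suc to lsuc)
open import Data.Nat.Base using (ℕ; zero; suc)
open import Data.Product.Base using (Σ; ∃; _×_; _,_; proj₁; proj₂)
open import Data.Unit.Polymorphic.Base using (tt)
open import Function.Base using (id; _∘_)
open import Function.Bundles using (_⇔_; mk⇔)
open import Function.Definitions using (Injective)
open import Relation.Binary.PropositionalEquality
  using (_≡_; refl; sym; trans; cong; cong₂; subst; module ≡-Reasoning)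
open import Relation.Binary.Core using (Rel)
open import Relation.Binary.Structures using (IsEquivalence)
import Relation.Binary.Construct.Closure.Equivalence as EqC
open import Relation.Nullary.Irrelevant using () renaming (Irrelevant to isProp)
open import Algebra.Bundles using (AbelianGroup)
import Algebra.Properties.AbelianGroup as AbelianGroupProperties
import Algebra.Properties.CommutativeSemigroup as CommutativeSemigroupProperties
open import Defs

-- Call a commutative square of groups bicartesian if its source is the
-- pullback and its target is covered by the other two corners.  Extensions
-- given on these corners that agree on the source glue to the target, provided
-- one of the maps out of the source is injective.  The same gluing for
-- Extⁿ follows by induction on n: when Extⁿ glues, any zigzag in ESⁿ⁺¹
-- collapses to a single cospan of zigs, and gluing the AbSES components over
-- its apex glues Extⁿ⁺¹.  Exactness at Extⁿ(E , G) is gluing for the square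
-- with corners A, 0, E, B; at the other two places it is read off from a
-- cospan joining an element to the base point.

open AbGroup using (Carrier; carrier-set)
open Hom using (⟦_⟧)
open ≡-Reasoning

private variable
  a r ℓ : Level

-- Auxiliary facts on abelian groups and their homomorphisms.

module AbGroupProperties (X : AbGroup ℓ) where
  open AbGroup X
  open AbelianGroupProperties abelianGroup public
    using (⁻¹-involutive)
  open CommutativeSemigroupProperties (AbelianGroup.commutativeSemigroup abelianGroup) public
    using (interchange)

  x∙y⁻¹∙y≈x : ∀ x y → (x ∙ y ⁻¹) ∙ y ≡ x
  x∙y⁻¹∙y≈x x y = trans (assoc x (y ⁻¹) y) (trans (cong (x ∙_) (inverseˡ y)) (identityʳ x))

module _ {X Y : AbGroup ℓ} (f : Hom X Y) where
  private
    module X = AbGroup X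
    module Y = AbGroup Y

  kernel-trivial⇒injective : (∀ x → ⟦ f ⟧ x ≡ Y.ε → x ≡ X.ε) → Injective _≡_ _≡_ ⟦ f ⟧
  kernel-trivial⇒injective ker {x} {y} e = X.x∙y⁻¹≈ε⇒x≈y x y (ker _ (begin
    ⟦ f ⟧ (x X.∙ y X.⁻¹)         ≡⟨ Hom.homo f x (y X.⁻¹) ⟩
    ⟦ f ⟧ x Y.∙ ⟦ f ⟧ (y X.⁻¹)   ≡⟨ cong₂ Y._∙_ e (Hom.⁻¹-homo f y) ⟩
    ⟦ f ⟧ y Y.∙ ⟦ f ⟧ y Y.⁻¹     ≡⟨ Y.inverseʳ _ ⟩
    Y.ε                          ∎))

  injective⇒kernel-trivial : Injective _≡_ _≡_ ⟦ f ⟧ → ∀ x → ⟦ f ⟧ x ≡ Y.ε → x ≡ X.ε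
  injective⇒kernel-trivial inj x e = inj (trans e (sym (Hom.ε-homo f)))

outˡ : {X Y : AbGroup ℓ} → Hom (X ⊕ Y) X
outˡ = ∙-Hom proj₁ λ _ _ → refl

module _ {X Y Z : AbGroup ℓ} where
  private
    module Z = AbGroup Z

  ⟨_,_⟩ₕ : Hom X Y → Hom X Z → Hom X (Y ⊕ Z)
  ⟨ f , g ⟩ₕ = ∙-Hom (λ x → ⟦ f ⟧ x , ⟦ g ⟧ x) λ x y → cong₂ _,_ (Hom.homo f x y) (Hom.homo g x y)

  [_,_]ₕ : Hom X Z → Hom Y Z → Hom (X ⊕ Y) Z
  [ f , g ]ₕ = ∙-Hom (λ (x , y) → ⟦ f ⟧ x Z.∙ ⟦ g ⟧ y) λ (x , y) (x′ , y′) →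
    trans (cong₂ Z._∙_ (Hom.homo f x x′) (Hom.homo g y y′)) (interchange _ _ _ _)
    where open AbGroupProperties Z

module ExtExactness (ua : Univalence) (hits : HITs) where
  open HITs hits
  open UnivalenceProperties ua
  open HITProperties hits
  open Yoneda ua hits
  open AbSES using (mid; incl; proj)

  -- Effective quotients, bicartesian squares and pushouts of groups.

  module _ {A : Set a} {R : Rel A r} (R-prop : ∀ {x y} → isProp (R x y)) (R-equiv : IsEquivalence R) where
    private
      module R = IsEquivalence R-equiv

    -- Encode-decode: by propositional extensionality `R x` descends to a family of propositions on
    -- the quotient, along which reflexivity is transported.
    quot-effective : ∀ {x y} → _≡_ {A = A / R} [ x ] [ y ] → R x y
    quot-effective {x} {y} e =
      subst proj₁ (code-β y) (subst (proj₁ ∘ code) e (subst proj₁ (sym (code-β x)) R.refl))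
      where
      code-resp : ∀ {y z} → R y z → _≡_ {A = hProp r} (R x y , R-prop) (R x z , R-prop)
      code-resp s = hProp-≡ (λ t → R.trans t s) (λ t → R.trans t (R.sym s))

      code : A / R → hProp r
      code = quot-rec hProp-set (λ y → R x y , R-prop) code-resp

      code-β : ∀ y → code [ y ] ≡ (R x y , R-prop)
      code-β = quot-rec-β hProp-set (λ y → R x y , R-prop) code-resp

  -- The fields say that `M → N ⊕ Q → P → 0` is exact, the second map being the difference of `k`
  -- and `l`. The preimages in `exact` are unique as soon as `h` or `j` is injective.
  record IsBicartesian {M N Q P : AbGroup ℓ} (h : Hom M N) (j : Hom M Q)
                       (k : Hom N P) (l : Hom Q P) : Set ℓ where
    private
      module P = AbGroup P
    field
      commutes : ∀ m → ⟦ k ⟧ (⟦ h ⟧ m) ≡ ⟦ l ⟧ (⟦ j ⟧ m)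
      covers   : ∀ p → ∥ (∃ λ n → ∃ λ q → ⟦ k ⟧ n P.∙ ⟦ l ⟧ q ≡ p) ∥
      exact    : ∀ n q → ⟦ k ⟧ n ≡ ⟦ l ⟧ q → ∥ (∃ λ m → ⟦ h ⟧ m ≡ n × ⟦ j ⟧ m ≡ q) ∥

  module Pushout {M N Q : AbGroup ℓ} (h : Hom M N) (j : Hom M Q) where
    private
      module M  = AbGroup M
      module N  = AbGroup N
      module Q  = AbGroup Q
      module N′ = AbGroupProperties N
      module Q′ = AbGroupProperties Q

      difference : Hom M (N ⊕ Q)
      difference = ∙-Hom (λ m → ⟦ h ⟧ m , ⟦ j ⟧ m Q.⁻¹) λ x y → cong₂ _,_ (Hom.homo h x y)
        (trans (cong Q._⁻¹ (Hom.homo j x y)) (sym (Q.⁻¹-∙-comm _ _)))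

    open Coker difference using (coker-proj; coker-rec; coker-rec-β; coker-effective) renaming (Coker to P) public

    private
      module P = AbGroup P

    inj₁ : Hom N P
    inj₁ = coker-proj ∘ₕ inˡ

    inj₂ : Hom Q P
    inj₂ = coker-proj ∘ₕ inʳ

    opaque
      inj-∙ : ∀ n q → ⟦ coker-proj ⟧ (n , q) ≡ ⟦ inj₁ ⟧ n P.∙ ⟦ inj₂ ⟧ q
      inj-∙ n q = trans
        (cong ⟦ coker-proj ⟧ (cong₂ _,_ (sym (N.identityʳ n)) (sym (Q.identityˡ q))))
        (Hom.homo coker-proj (n , Q.ε) (N.ε , q))

      isBicartesian : IsBicartesian h j inj₁ inj₂
      isBicartesian = record
        -- The quotient relation compares `u ⁻¹ ∙ v`, so the element linking `(h m , ε)` to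
        -- `(ε , j m)` is `m ⁻¹`. The same sign is undone in `exact`.
        { commutes = λ m → quot-eq ∣ m M.⁻¹ , cong₂ _,_
            (trans (Hom.⁻¹-homo h m) (sym (N.identityʳ _)))
            (begin
              ⟦ j ⟧ (m M.⁻¹) Q.⁻¹     ≡⟨ cong Q._⁻¹ (Hom.⁻¹-homo j m) ⟩
              ⟦ j ⟧ m Q.⁻¹ Q.⁻¹       ≡⟨ Q′.⁻¹-involutive _ ⟩
              ⟦ j ⟧ m                 ≡⟨ Q.identityˡ _ ⟨
              Q.ε Q.∙ ⟦ j ⟧ m         ≡⟨ cong (Q._∙ ⟦ j ⟧ m) Q.ε⁻¹≈ε ⟨
              Q.ε Q.⁻¹ Q.∙ ⟦ j ⟧ m    ∎) ∣
        ; covers = quot-elimProp _ (λ _ → squash) λ (n , q) → ∣ n , q , sym (inj-∙ n q) ∣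
        ; exact = λ n q e → trunc-map
            (λ (m , d) → m M.⁻¹ ,
              (begin
                ⟦ h ⟧ (m M.⁻¹)        ≡⟨ Hom.⁻¹-homo h m ⟩
                ⟦ h ⟧ m N.⁻¹          ≡⟨ cong N._⁻¹ (trans (cong proj₁ d) (N.identityʳ _)) ⟩
                n N.⁻¹ N.⁻¹           ≡⟨ N′.⁻¹-involutive n ⟩
                n                     ∎) ,
              (begin
                ⟦ j ⟧ (m M.⁻¹)        ≡⟨ Hom.⁻¹-homo j m ⟩
                ⟦ j ⟧ m Q.⁻¹          ≡⟨ cong proj₂ d ⟩
                Q.ε Q.⁻¹ Q.∙ q        ≡⟨ cong (Q._∙ q) Q.ε⁻¹≈ε ⟩
                Q.ε Q.∙ q             ≡⟨ Q.identityˡ q ⟩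
                q                     ∎))
            (coker-effective ua e)
        }

    module _ {Z : AbGroup ℓ} (f : Hom N Z) (g : Hom Q Z) (fh≡gj : ∀ m → ⟦ f ⟧ (⟦ h ⟧ m) ≡ ⟦ g ⟧ (⟦ j ⟧ m)) where
      private
        module Z = AbGroup Z

        opaque
          kills : ∀ m → ⟦ f ⟧ (⟦ h ⟧ m) Z.∙ ⟦ g ⟧ (⟦ j ⟧ m Q.⁻¹) ≡ Z.ε
          kills m = trans (cong₂ Z._∙_ (fh≡gj m) (Hom.⁻¹-homo g _)) (Z.inverseʳ _)

      copair : Hom P Z
      copair = coker-rec [ f , g ]ₕ kills

      opaque
        copair-inj₁ : ∀ n → ⟦ copair ⟧ (⟦ inj₁ ⟧ n) ≡ ⟦ f ⟧ n
        copair-inj₁ n = trans (coker-rec-β [ f , g ]ₕ kills _)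
          (trans (cong (⟦ f ⟧ n Z.∙_) (Hom.ε-homo g)) (Z.identityʳ _))

        copair-inj₂ : ∀ q → ⟦ copair ⟧ (⟦ inj₂ ⟧ q) ≡ ⟦ g ⟧ q
        copair-inj₂ q = trans (coker-rec-β [ f , g ]ₕ kills _)
          (trans (cong (Z._∙ ⟦ g ⟧ q) (Hom.ε-homo f)) (Z.identityˡ _))

  -- Gluing extensions over a bicartesian square.

  module _ {M N Q P X : AbGroup ℓ} {h : Hom M N} {j : Hom M Q} {k : Hom N P} {l : Hom Q P}
           (sq : IsBicartesian h j k l) (j-inj : Injective _≡_ _≡_ ⟦ j ⟧)
           (F₀ : AbSES M X) (F₁ : AbSES N X) (F₂ : AbSES Q X)
           (α : Hom (mid F₀) (mid F₁)) (β : Hom (mid F₀) (mid F₂))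
           (α-incl : ∀ x → ⟦ α ⟧ (⟦ incl F₀ ⟧ x) ≡ ⟦ incl F₁ ⟧ x)
           (β-incl : ∀ x → ⟦ β ⟧ (⟦ incl F₀ ⟧ x) ≡ ⟦ incl F₂ ⟧ x)
           (α-proj : ∀ z → ⟦ proj F₁ ⟧ (⟦ α ⟧ z) ≡ ⟦ h ⟧ (⟦ proj F₀ ⟧ z))
           (β-proj : ∀ z → ⟦ proj F₂ ⟧ (⟦ β ⟧ z) ≡ ⟦ j ⟧ (⟦ proj F₀ ⟧ z)) where
    private
      module X  = AbGroup X
      module N  = AbGroup N
      module Q  = AbGroup Q
      module P  = AbGroup P
      module M₀ = AbGroup (mid F₀)
      module M₁ = AbGroup (mid F₁)
      module M₂ = AbGroup (mid F₂)
      module F₀ = AbSES F₀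
      module F₁ = AbSES F₁
      module F₂ = AbSES F₂
      module sq = IsBicartesian sq
      module PO = Pushout α β
      module PO-sq = IsBicartesian PO.isBicartesian
      module W  = AbGroup PO.P
      open PO using (inj₁; inj₂)

      opaque
        kα≡lβ : ∀ z → ⟦ k ⟧ (⟦ F₁.proj ⟧ (⟦ α ⟧ z)) ≡ ⟦ l ⟧ (⟦ F₂.proj ⟧ (⟦ β ⟧ z))
        kα≡lβ z = trans (cong ⟦ k ⟧ (α-proj z)) (trans (sq.commutes _) (cong ⟦ l ⟧ (sym (β-proj z))))

      glued-proj : Hom PO.P P
      glued-proj = PO.copair (k ∘ₕ F₁.proj) (l ∘ₕ F₂.proj) kα≡lβ

      glued-incl : Hom X PO.P
      glued-incl = inj₁ ∘ₕ F₁.incl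

      opaque
        proj-inj₁ : ∀ m → ⟦ glued-proj ⟧ (⟦ inj₁ ⟧ m) ≡ ⟦ k ⟧ (⟦ F₁.proj ⟧ m)
        proj-inj₁ = PO.copair-inj₁ (k ∘ₕ F₁.proj) (l ∘ₕ F₂.proj) kα≡lβ

        proj-inj₂ : ∀ m → ⟦ glued-proj ⟧ (⟦ inj₂ ⟧ m) ≡ ⟦ l ⟧ (⟦ F₂.proj ⟧ m)
        proj-inj₂ = PO.copair-inj₂ (k ∘ₕ F₁.proj) (l ∘ₕ F₂.proj) kα≡lβ

        proj-∙ : ∀ m m′ → ⟦ glued-proj ⟧ (⟦ inj₁ ⟧ m W.∙ ⟦ inj₂ ⟧ m′) ≡ ⟦ k ⟧ (⟦ F₁.proj ⟧ m) P.∙ ⟦ l ⟧ (⟦ F₂.proj ⟧ m′)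
        proj-∙ m m′ = trans (Hom.homo glued-proj _ _) (cong₂ P._∙_ (proj-inj₁ m) (proj-inj₂ m′))

        inj₂-incl : ∀ x → ⟦ inj₂ ⟧ (⟦ F₂.incl ⟧ x) ≡ ⟦ glued-incl ⟧ x
        inj₂-incl x = trans (cong ⟦ inj₂ ⟧ (sym (β-incl x)))
          (trans (sym (PO-sq.commutes _)) (cong ⟦ inj₁ ⟧ (α-incl x)))

        -- If `⟦ F₁.incl ⟧ x` dies in the pushout, it is `α z` for some `z` with `β z ≡ ε`.
        -- Injectivity of `j` forces such a `z` to come from `X`, where `β` is injective, so
        -- `z ≡ ε`.
        glued-injective : Injective _≡_ _≡_ ⟦ glued-incl ⟧
        glued-injective = kernel-trivial⇒injective glued-incl λ x e → trunc-rec X.carrier-set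
          (λ (z , αz≡ , βz≡ε) →
            let z≡ε : z ≡ M₀.ε
                z≡ε = trunc-rec M₀.carrier-set
                  (λ (y , iy≡z) → trans (sym iy≡z) (trans
                    (cong ⟦ F₀.incl ⟧ (injective⇒kernel-trivial F₂.incl F₂.injective y
                      (trans (sym (β-incl y)) (trans (cong ⟦ β ⟧ iy≡z) βz≡ε))))
                    (Hom.ε-homo F₀.incl)))
                  (F₀.exact z (injective⇒kernel-trivial j j-inj _
                    (trans (sym (β-proj z)) (trans (cong ⟦ F₂.proj ⟧ βz≡ε) (Hom.ε-homo F₂.proj)))))
            in injective⇒kernel-trivial F₁.incl F₁.injective x
                 (trans (sym αz≡) (trans (cong ⟦ α ⟧ z≡ε) (Hom.ε-homo α))))
          (PO-sq.exact (⟦ F₁.incl ⟧ x) M₂.ε (trans e (sym (Hom.ε-homo inj₂))))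

        glued-surjective : ∀ p → ∥ (∃ λ w → ⟦ glued-proj ⟧ w ≡ p) ∥
        glued-surjective p = trunc-rec squash
          (λ (n , q , kn∙lq≡p) → trunc-rec squash (λ (m , e) → trunc-map (λ (m′ , e′) →
            ⟦ inj₁ ⟧ m W.∙ ⟦ inj₂ ⟧ m′ ,
            trans (proj-∙ m m′) (trans (cong₂ P._∙_ (cong ⟦ k ⟧ e) (cong ⟦ l ⟧ e′)) kn∙lq≡p))
            (F₂.surjective q)) (F₁.surjective n))
          (sq.covers p)

        glued-complex : ∀ x → ⟦ glued-proj ⟧ (⟦ glued-incl ⟧ x) ≡ P.ε
        glued-complex x = trans (proj-inj₁ _) (trans (cong ⟦ k ⟧ (F₁.complex x)) (Hom.ε-homo k))

        -- Correcting the representative (m , m′) by a lift z of the common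
        -- preimage in M moves both components into X.
        glued-exact-∙ : ∀ m m′ → ⟦ k ⟧ (⟦ F₁.proj ⟧ m) P.∙ ⟦ l ⟧ (⟦ F₂.proj ⟧ m′) ≡ P.ε →
                        ∥ (∃ λ x → ⟦ glued-incl ⟧ x ≡ ⟦ inj₁ ⟧ m W.∙ ⟦ inj₂ ⟧ m′) ∥
        glued-exact-∙ m m′ e = trunc-rec squash
          (λ (y , hy≡ , jy≡) → trunc-rec squash (λ (z , qz≡y) →
            trunc-rec squash (λ (x , ix≡) → trunc-map (λ (x′ , ix′≡) → x X.∙ x′ , (begin
              ⟦ glued-incl ⟧ (x X.∙ x′)
                ≡⟨ Hom.homo glued-incl x x′ ⟩
              ⟦ glued-incl ⟧ x W.∙ ⟦ glued-incl ⟧ x′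
                ≡⟨ cong (⟦ glued-incl ⟧ x W.∙_) (inj₂-incl x′) ⟨
              ⟦ inj₁ ⟧ (⟦ F₁.incl ⟧ x) W.∙ ⟦ inj₂ ⟧ (⟦ F₂.incl ⟧ x′)
                ≡⟨ cong₂ (λ u v → ⟦ inj₁ ⟧ u W.∙ ⟦ inj₂ ⟧ v) ix≡ ix′≡ ⟩
              ⟦ inj₁ ⟧ (m M₁.∙ ⟦ α ⟧ z M₁.⁻¹) W.∙ ⟦ inj₂ ⟧ (⟦ β ⟧ z M₂.∙ m′)
                ≡⟨ cong (⟦ inj₁ ⟧ (m M₁.∙ ⟦ α ⟧ z M₁.⁻¹) W.∙_) (Hom.homo inj₂ _ _) ⟩
              ⟦ inj₁ ⟧ (m M₁.∙ ⟦ α ⟧ z M₁.⁻¹) W.∙ (⟦ inj₂ ⟧ (⟦ β ⟧ z) W.∙ ⟦ inj₂ ⟧ m′)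
                ≡⟨ cong (λ w → ⟦ inj₁ ⟧ (m M₁.∙ ⟦ α ⟧ z M₁.⁻¹) W.∙ (w W.∙ ⟦ inj₂ ⟧ m′)) (PO-sq.commutes z) ⟨
              ⟦ inj₁ ⟧ (m M₁.∙ ⟦ α ⟧ z M₁.⁻¹) W.∙ (⟦ inj₁ ⟧ (⟦ α ⟧ z) W.∙ ⟦ inj₂ ⟧ m′)
                ≡⟨ W.assoc _ _ _ ⟨
              (⟦ inj₁ ⟧ (m M₁.∙ ⟦ α ⟧ z M₁.⁻¹) W.∙ ⟦ inj₁ ⟧ (⟦ α ⟧ z)) W.∙ ⟦ inj₂ ⟧ m′
                ≡⟨ cong (W._∙ ⟦ inj₂ ⟧ m′) (Hom.homo inj₁ _ _) ⟨
              ⟦ inj₁ ⟧ (m M₁.∙ ⟦ α ⟧ z M₁.⁻¹ M₁.∙ ⟦ α ⟧ z) W.∙ ⟦ inj₂ ⟧ m′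
                ≡⟨ cong (λ u → ⟦ inj₁ ⟧ u W.∙ ⟦ inj₂ ⟧ m′) (AbGroupProperties.x∙y⁻¹∙y≈x (mid F₁) m _) ⟩
              ⟦ inj₁ ⟧ m W.∙ ⟦ inj₂ ⟧ m′
                ∎))
              (F₂.exact (⟦ β ⟧ z M₂.∙ m′) (begin
                ⟦ F₂.proj ⟧ (⟦ β ⟧ z M₂.∙ m′)                   ≡⟨ Hom.homo F₂.proj _ _ ⟩
                ⟦ F₂.proj ⟧ (⟦ β ⟧ z) Q.∙ ⟦ F₂.proj ⟧ m′        ≡⟨ cong (Q._∙ _) (trans (β-proj z) (cong ⟦ j ⟧ qz≡y)) ⟩
                ⟦ j ⟧ y Q.∙ ⟦ F₂.proj ⟧ m′                      ≡⟨ cong (Q._∙ _) jy≡ ⟩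
                ⟦ F₂.proj ⟧ m′ Q.⁻¹ Q.∙ ⟦ F₂.proj ⟧ m′          ≡⟨ Q.inverseˡ _ ⟩
                Q.ε                                             ∎)))
              (F₁.exact (m M₁.∙ ⟦ α ⟧ z M₁.⁻¹) (begin
                ⟦ F₁.proj ⟧ (m M₁.∙ ⟦ α ⟧ z M₁.⁻¹)              ≡⟨ Hom.homo F₁.proj _ _ ⟩
                ⟦ F₁.proj ⟧ m N.∙ ⟦ F₁.proj ⟧ (⟦ α ⟧ z M₁.⁻¹)   ≡⟨ cong (_ N.∙_) (Hom.⁻¹-homo F₁.proj _) ⟩
                ⟦ F₁.proj ⟧ m N.∙ ⟦ F₁.proj ⟧ (⟦ α ⟧ z) N.⁻¹    ≡⟨ cong (λ n → ⟦ F₁.proj ⟧ m N.∙ n N.⁻¹) (trans (α-proj z) (trans (cong ⟦ h ⟧ qz≡y) hy≡)) ⟩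
                ⟦ F₁.proj ⟧ m N.∙ ⟦ F₁.proj ⟧ m N.⁻¹            ≡⟨ N.inverseʳ _ ⟩
                N.ε                                             ∎)))
            (F₀.surjective y))
          (sq.exact (⟦ F₁.proj ⟧ m) (⟦ F₂.proj ⟧ m′ Q.⁻¹)
            (trans (P.inverseˡ-unique _ _ e) (sym (Hom.⁻¹-homo l _))))

        glued-exact : ∀ w → ⟦ glued-proj ⟧ w ≡ P.ε → ∥ (∃ λ x → ⟦ glued-incl ⟧ x ≡ w) ∥
        glued-exact w e = trunc-rec squash
          (λ { (m , m′ , refl) → glued-exact-∙ m m′ (trans (sym (proj-∙ m m′)) e) })
          (PO-sq.covers w)

      glued : AbSES P X
      glued = mkAbSES PO.P glued-incl glued-proj record
        { injective  = glued-injective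
        ; surjective = glued-surjective
        ; complex    = glued-complex
        ; exact      = glued-exact
        }

    -- `inj₁` and `inj₂` are morphisms of extensions that fix `X` and lie over `k` and `l`; such a
    -- morphism identifies its source with a pullback.
    glue-over : Σ (AbSES P X) λ F → F₁ ≡ pullSES k F × F₂ ≡ pullSES l F
    glue-over = glued ,
      pullSES-path k glued inj₁ (λ _ → refl) proj-inj₁ ,
      pullSES-path l glued inj₂ inj₂-incl proj-inj₂

  -- Splitting, composing and gluing short exact sequences.

  module _ {Y X : AbGroup ℓ} where

    -- Converse to `abSES-path`: sections and retractions can be carried along a path of extensions.
    path⇒hom : {E E′ : AbSES Y X} → E ≡ E′ → Hom (mid E) (mid E′)
    path⇒hom {E} e = subst (λ E′ → Hom (mid E) (mid E′)) e idHom

    path⇒hom-incl : {E E′ : AbSES Y X} (e : E ≡ E′) → ∀ x → ⟦ path⇒hom e ⟧ (⟦ incl E ⟧ x) ≡ ⟦ incl E′ ⟧ x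
    path⇒hom-incl refl x = refl

    path⇒hom-proj : {E E′ : AbSES Y X} (e : E ≡ E′) → ∀ m → ⟦ proj E′ ⟧ (⟦ path⇒hom e ⟧ m) ≡ ⟦ proj E ⟧ m
    path⇒hom-proj refl m = refl

  module _ {Y Y′ X : AbGroup ℓ} (g : Hom Y′ Y) (E : AbSES Y X) where
    private
      module Y = AbGroup Y
      module M = AbGroup (mid E)
      module E = AbSES E

    pullSES-top : Hom (mid (pullSES g E)) (mid E)
    pullSES-top = ∙-Hom (proj₁ ∘ proj₁) λ _ _ → refl

    opaque
      -- `[ E.incl , s ]ₕ` is a morphism from the trivial extension to `E` over `g`, which makes its
      -- source the pullback.
      lift⇒pullSES-trivial : (s : Hom Y′ (mid E)) → (∀ y → ⟦ E.proj ⟧ (⟦ s ⟧ y) ≡ ⟦ g ⟧ y) →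
                             pullSES g E ≡ trivialSES
      lift⇒pullSES-trivial s s-proj = sym (pullSES-path g E [ E.incl , s ]ₕ
        (λ x → trans (cong (⟦ E.incl ⟧ x M.∙_) (Hom.ε-homo s)) (M.identityʳ _))
        (λ (x , y) → trans (Hom.homo E.proj _ _)
          (trans (cong₂ Y._∙_ (E.complex x) (s-proj y)) (Y.identityˡ _))))

      -- The lift is the canonical section of the trivial extension, carried to the pullback and
      -- projected to `mid E`.
      pullSES-trivial⇒lift : pullSES g E ≡ trivialSES →
                             Σ (Hom Y′ (mid E)) λ s → ∀ y → ⟦ E.proj ⟧ (⟦ s ⟧ y) ≡ ⟦ g ⟧ y
      pullSES-trivial⇒lift e = pullSES-top ∘ₕ (path⇒hom (sym e) ∘ₕ inʳ {X = X}) , λ y →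
        trans (proj₂ (⟦ path⇒hom (sym e) ⟧ (AbGroup.ε X , y))) (cong ⟦ g ⟧ (path⇒hom-proj (sym e) (AbGroup.ε X , y)))

  opaque
    pullSES-∘ : {Y Y′ Y″ X : AbGroup ℓ} (g : Hom Y′ Y) (f : Hom Y″ Y′) (E : AbSES Y X) →
                pullSES (g ∘ₕ f) E ≡ pullSES f (pullSES g E)
    pullSES-∘ g f E = pullSES-path f (pullSES g E)
      (∙-Hom (λ ((m , y) , e) → (m , ⟦ f ⟧ y) , e) λ _ _ → pullback-≡ (proj E) g refl (Hom.homo f _ _))
      (λ _ → pullback-≡ (proj E) g refl (Hom.ε-homo f))
      (λ _ → refl)

  module _ {Y X X′ : AbGroup ℓ} (f : Hom X X′) (E : AbSES Y X) where
    private
      module X′ = AbGroup X′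
      module M  = AbGroup (mid E)
      module E  = AbSES E
    open Coker (antidiagonal f E)

    pushSES-bottom : Hom (mid E) (mid (pushSES f E))
    pushSES-bottom = coker-proj ∘ₕ inʳ

    opaque
      pushSES-bottom-proj : ∀ m → ⟦ proj (pushSES f E) ⟧ (⟦ pushSES-bottom ⟧ m) ≡ ⟦ E.proj ⟧ m
      pushSES-bottom-proj m = coker-rec-β (proj∘outʳ f E) (proj∘outʳ-kills f E) (X′.ε , m)

      pushSES-bottom-incl : ∀ x → ⟦ pushSES-bottom ⟧ (⟦ E.incl ⟧ x) ≡ ⟦ incl (pushSES f E) ⟧ (⟦ f ⟧ x)
      pushSES-bottom-incl x = quot-eq ∣ x , cong₂ _,_
        (sym (trans (cong (X′._∙ _) X′.ε⁻¹≈ε) (X′.identityˡ _))) (sym (M.identityʳ _)) ∣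

      -- Dually, `⟨ r , E.proj ⟩ₕ` is a morphism from `E` to the trivial extension under `f`.
      extension⇒pushSES-trivial : (r : Hom (mid E) X′) → (∀ x → ⟦ r ⟧ (⟦ E.incl ⟧ x) ≡ ⟦ f ⟧ x) →
                                  pushSES f E ≡ trivialSES
      extension⇒pushSES-trivial r r-incl = pushSES-path f E ⟨ r , E.proj ⟩ₕ
        (λ x → cong₂ _,_ (r-incl x) (E.complex x)) (λ _ → refl)

      pushSES-trivial⇒extension : pushSES f E ≡ trivialSES →
                                  Σ (Hom (mid E) X′) λ r → ∀ x → ⟦ r ⟧ (⟦ E.incl ⟧ x) ≡ ⟦ f ⟧ x
      pushSES-trivial⇒extension e = outˡ ∘ₕ (path⇒hom e ∘ₕ pushSES-bottom) , λ x →
        trans (cong (proj₁ ∘ ⟦ path⇒hom e ⟧) (pushSES-bottom-incl x)) (cong proj₁ (path⇒hom-incl e (⟦ f ⟧ x)))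

  opaque
    pushSES-∘ : {Y X X′ X″ : AbGroup ℓ} (g : Hom X′ X″) (f : Hom X X′) (E : AbSES Y X) →
                pushSES (g ∘ₕ f) E ≡ pushSES g (pushSES f E)
    pushSES-∘ g f E = pushSES-path (g ∘ₕ f) E (pushSES-bottom g (pushSES f E) ∘ₕ pushSES-bottom f E)
      (λ x → trans (cong ⟦ pushSES-bottom g (pushSES f E) ⟧ (pushSES-bottom-incl f E x))
                   (pushSES-bottom-incl g (pushSES f E) _))
      (λ m → trans (pushSES-bottom-proj g (pushSES f E) _) (pushSES-bottom-proj f E m))

    -- Correcting the canonical map `mid E → mid (pushSES g E)` by `G.incl ∘ₕ w` changes its
    -- restriction from `g` to `f`, and `G.proj` does not see the correction.
    pushSES-homotopic : {Y X X′ : AbGroup ℓ} (E : AbSES Y X) (f g : Hom X X′) (w : Hom (mid E) X′) →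
                        (∀ x → ⟦ f ⟧ x ≡ AbGroup._∙_ X′ (⟦ g ⟧ x) (⟦ w ⟧ (⟦ incl E ⟧ x))) →
                        pushSES f E ≡ pushSES g E
    pushSES-homotopic {Y = Y} {X′ = X′} E f g w f≡g∙w = pushSES-path f E φ
      (λ x → begin
        ⟦ bottom ⟧ (⟦ incl E ⟧ x) W.∙ ⟦ G.incl ⟧ (⟦ w ⟧ (⟦ incl E ⟧ x))
          ≡⟨ cong (W._∙ ⟦ G.incl ⟧ (⟦ w ⟧ (⟦ incl E ⟧ x))) (pushSES-bottom-incl g E x) ⟩
        ⟦ G.incl ⟧ (⟦ g ⟧ x) W.∙ ⟦ G.incl ⟧ (⟦ w ⟧ (⟦ incl E ⟧ x))
          ≡⟨ Hom.homo G.incl _ _ ⟨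
        ⟦ G.incl ⟧ (AbGroup._∙_ X′ (⟦ g ⟧ x) (⟦ w ⟧ (⟦ incl E ⟧ x)))
          ≡⟨ cong ⟦ G.incl ⟧ (f≡g∙w x) ⟨
        ⟦ G.incl ⟧ (⟦ f ⟧ x)
          ∎)
      (λ m → trans (Hom.homo G.proj _ _)
        (trans (cong₂ Y._∙_ (pushSES-bottom-proj g E m) (G.complex (⟦ w ⟧ m))) (Y.identityʳ _)))
      where
      module Y = AbGroup Y
      module W = AbGroup (mid (pushSES g E))
      module G = AbSES (pushSES g E)

      bottom : Hom (mid E) G.mid
      bottom = pushSES-bottom g E

      φ : Hom (mid E) G.mid
      -- The pointwise product of the two maps, written as a copairing after the diagonal.
      φ = [ bottom , G.incl ∘ₕ w ]ₕ ∘ₕ ⟨ idHom , idHom ⟩ₕ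

  module _ {X M Y Z : AbGroup ℓ} {j : Hom X M} {q : Hom M Y} (ses : IsSES j q)
           (f : Hom Z M) (qf≡ε : ∀ z → ⟦ q ⟧ (⟦ f ⟧ z) ≡ AbGroup.ε Y) where
    private
      module ses = IsSES ses
      module M = AbGroup M

      -- Injectivity of `j` makes its fibres propositions, so the merely existing preimages given by
      -- exactness can be chosen.
      factor-fiber : ∀ z → fiber ⟦ j ⟧ (⟦ f ⟧ z)
      factor-fiber z = trunc-rec (λ (_ , d) (_ , e) → Σ-prop-≡ (λ _ → M.carrier-set) (ses.injective (trans d (sym e))))
        id (ses.exact (⟦ f ⟧ z) (qf≡ε z))

    kernel-factor : Σ (Hom Z X) λ w → ∀ z → ⟦ j ⟧ (⟦ w ⟧ z) ≡ ⟦ f ⟧ z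
    kernel-factor = ∙-Hom (proj₁ ∘ factor-fiber) (λ x y → ses.injective (trans (proj₂ (factor-fiber _))
        (trans (Hom.homo f x y) (sym (trans (Hom.homo j _ _)
          (cong₂ M._∙_ (proj₂ (factor-fiber x)) (proj₂ (factor-fiber y)))))))) ,
      proj₂ ∘ factor-fiber

  opaque
    -- The splitting is a lift `s` of `proj E` to `mid D`. On `A` it lands in the kernel `X`, which
    -- defines `w`, and `s` is then a morphism from `E` to `D` under `w`.
    pullSES-proj-trivial⇒pushSES : {B A X : AbGroup ℓ} (E : AbSES B A) (D : AbSES B X) →
                                   pullSES (proj E) D ≡ trivialSES → Σ (Hom A X) λ w → pushSES w E ≡ D
    pullSES-proj-trivial⇒pushSES E D e =
      let s , s-proj = pullSES-trivial⇒lift (proj E) D e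
          w , w-incl = kernel-factor (AbSES.isSES D) (s ∘ₕ incl E) λ a → trans (s-proj _) (AbSES.complex E a)
      in w , pushSES-path w E s (λ a → sym (w-incl a)) s-proj

    glueSES : {M N Q P X : AbGroup ℓ} {h : Hom M N} {j : Hom M Q} {k : Hom N P} {l : Hom Q P} →
              IsBicartesian h j k l → Injective _≡_ _≡_ ⟦ j ⟧ →
              (F₁ : AbSES N X) (F₂ : AbSES Q X) → pullSES h F₁ ≡ pullSES j F₂ →
              Σ (AbSES P X) λ F → pullSES k F ≡ F₁ × pullSES l F ≡ F₂
    glueSES {h = h} {j} sq j-inj F₁ F₂ e =
      let F , e₁ , e₂ = glue-over sq j-inj (pullSES h F₁) F₁ F₂
            (pullSES-top h F₁)
            (pullSES-top j F₂ ∘ₕ path⇒hom e)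
            (λ _ → refl)
            (λ x → cong (proj₁ ∘ proj₁) (path⇒hom-incl e x))
            (λ z → proj₂ z)
            (λ z → trans (proj₂ (⟦ path⇒hom e ⟧ z)) (cong ⟦ j ⟧ (path⇒hom-proj e z)))
      in F , sym e₁ , sym e₂

  -- Calculus in `ES n` up to the relation generated by zigs.

  pull-∘ : ∀ n {Y Y′ Y″ X : AbGroup ℓ} (g : Hom Y′ Y) (f : Hom Y″ Y′) (F : ES n Y X) →
           pull n (g ∘ₕ f) F ≡ pull n f (pull n g F)
  pull-∘ zero          g f F           = cong lift (hom-≡ λ _ → refl)
  pull-∘ (suc zero)    g f E           = pullSES-∘ g f E
  pull-∘ (suc (suc n)) g f (M , F , E) = cong (λ D → M , F , D) (pullSES-∘ g f E)

  opaque
    -- The degree is explicit because it cannot be recovered from the type `ES n Y X`, which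
    -- computes by recursion on `n`.
    Equiv : ∀ n {Y X : AbGroup ℓ} → Rel (ES n Y X) (lsuc ℓ)
    Equiv n = _≈ES_ {n = n}

  infix 4 Equiv
  syntax Equiv n F F′ = F ≈[ n ] F′

  opaque
    unfolding Equiv

    ≈-isEquivalence : ∀ n {Y X : AbGroup ℓ} → IsEquivalence (Equiv n {Y} {X})
    ≈-isEquivalence n = record
      { refl  = ∣ EqC.reflexive (Zig n) ∣
      ; sym   = trunc-map (EqC.symmetric (Zig n))
      ; trans = λ s t → trunc-rec squash (λ s → trunc-map (EqC.transitive (Zig n) s) t) s
      }

    zig⇒≈ : ∀ n {Y X : AbGroup ℓ} {F F′ : ES n Y X} → Zig n F F′ → F ≈[ n ] F′
    zig⇒≈ n z = ∣ EqC.return z ∣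

    ≈-fold : ∀ n {Y X : AbGroup ℓ} {_∼_ : Rel (ES n Y X) r} → (∀ {F F′} → isProp (F ∼ F′)) → IsEquivalence _∼_ →
             (∀ {F F′} → Zig n F F′ → F ∼ F′) → ∀ {F F′} → F ≈[ n ] F′ → F ∼ F′
    ≈-fold n ∼-prop ∼-equiv zig⇒∼ = trunc-rec ∼-prop (EqC.fold ∼-equiv zig⇒∼)

    []-injective : ∀ n {Y X : AbGroup ℓ} {F F′ : ES n Y X} →
                   _≡_ {A = PointedSet.⟨ Ext n Y X ⟩} [ F ] [ F′ ] → F ≈[ n ] F′
    []-injective n = quot-effective squash (≈-isEquivalence n)

    []-cong : ∀ n {Y X : AbGroup ℓ} {F F′ : ES n Y X} →
              F ≈[ n ] F′ → _≡_ {A = PointedSet.⟨ Ext n Y X ⟩} [ F ] [ F′ ]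
    []-cong n = quot-eq

    ≈-map : ∀ m n {Y X Y′ X′ : AbGroup ℓ} (f : ES m Y X → ES n Y′ X′) →
            (∀ {F F′} → Zig m F F′ → Zig n (f F) (f F′)) →
            ∀ {F F′} → F ≈[ m ] F′ → f F ≈[ n ] f F′
    ≈-map m n f f-zig = trunc-map (EqC.gmap f f-zig)

  module ≈ {ℓ} n {Y X : AbGroup ℓ} = IsEquivalence (≈-isEquivalence n {Y} {X})

  -- In degree one a zig is a path, and truncated paths already form an equivalence relation.
  ≈⇒≡ : {Y X : AbGroup ℓ} {F F′ : AbSES Y X} → F ≈[ 1 ] F′ → ∥ (F ≡ F′) ∥
  ≈⇒≡ = ≈-fold 1 squash
    (record
      { refl  = ∣ refl ∣
      ; sym   = trunc-map sym
      ; trans = λ s t → trunc-rec squash (λ { refl → t }) s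
      })
    ∣_∣

  pull-cong : ∀ n {Y Y′ X : AbGroup ℓ} (g : Hom Y′ Y) {F F′ : ES n Y X} →
              F ≈[ n ] F′ → pull n g F ≈[ n ] pull n g F′
  pull-cong n g = ≈-map n n (pull n g) (zig-pull n g)

  splice-cong : ∀ n {X Y Z : AbGroup ℓ} (E : AbSES Z Y) {F F′ : ES (suc n) Y X} →
                F ≈[ suc n ] F′ → splice n F E ≈[ suc (suc n) ] splice n F′ E
  splice-cong n E = ≈-map (suc n) (suc (suc n)) (λ F → splice n F E) (zig-splice n E)

  -- The basic move: `u` itself is a zig, with the reflexive zig above, and carries a homomorphism
  -- across the splice.
  splice-push : ∀ n {X Y Y′ Z : AbGroup ℓ} (u : Hom Y Y′) {E : AbSES Z Y} {E′ : AbSES Z Y′} → pushSES u E ≡ E′ →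
                (F : ES (suc n) Y′ X) → splice n (pull (suc n) u F) E ≈[ suc (suc n) ] splice n F E′
  splice-push n u e F = zig⇒≈ (suc (suc n)) (u , e , zig-refl (suc n) {F = pull (suc n) u F} refl)

  opaque
    pullSES-zero : {Y Y′ X : AbGroup ℓ} (E : AbSES Y X) → pullSES (zeroHom {X = Y′}) E ≡ trivialSES
    pullSES-zero {Y′ = Y′} E = lift⇒pullSES-trivial zeroHom E (zeroHom {X = Y′}) λ _ → Hom.ε-homo (proj E)

    pushSES-trivial : {Y X X′ : AbGroup ℓ} (f : Hom X X′) → pushSES f (trivialSES {Y = Y}) ≡ trivialSES
    pushSES-trivial {Y = Y} f = extension⇒pushSES-trivial f (trivialSES {Y = Y}) (f ∘ₕ outˡ) λ _ → refl

  mutual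
    -- The trivial extension by `Y` is pushed out from the one by `𝟘`. Moving `𝟘 → Y` across the
    -- splice pulls `F` back to `𝟘`, where `pull-zero` applies.
    splice-trivial : ∀ n {X Y Z : AbGroup ℓ} (F : ES (suc n) Y X) →
                     splice n F (trivialSES {Y = Z}) ≈[ suc (suc n) ] ptES (suc (suc n))
    splice-trivial n {Z = Z} F = ≈.trans (suc (suc n))
      (≈.sym (suc (suc n)) (splice-push n zeroHom (pushSES-trivial {Y = Z} (zeroHom {X = 𝟘})) F))
      (splice-cong n trivialSES (pull-zero n F))

    -- The zero map lifts through any extension, so its pullback splits; above degree one this
    -- leaves a splice with a trivial extension, one step down the mutual recursion.
    pull-zero : ∀ n {X Y Y′ : AbGroup ℓ} (F : ES (suc n) Y X) →
                pull (suc n) (zeroHom {X = Y′}) F ≈[ suc n ] ptES (suc n)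
    pull-zero zero    E           = ≈.reflexive 1 (pullSES-zero E)
    pull-zero (suc n) (M , F , E) = ≈.trans (suc (suc n))
      (≈.reflexive (suc (suc n)) (cong (splice n F) (pullSES-zero E)))
      (splice-trivial n F)

  -- Cospans of zigs and gluing in all degrees.

  Gluing : ℕ → (ℓ : Level) → Set (lsuc ℓ)
  Gluing n ℓ = {M N Q P X : AbGroup ℓ} {h : Hom M N} {j : Hom M Q} {k : Hom N P} {l : Hom Q P} →
    IsBicartesian h j k l → Injective _≡_ _≡_ ⟦ j ⟧ →
    (F₁ : ES (suc n) N X) (F₂ : ES (suc n) Q X) → pull (suc n) h F₁ ≈[ suc n ] pull (suc n) j F₂ →
    ∥ (Σ (ES (suc n) P X) λ F → pull (suc n) k F ≈[ suc n ] F₁ × pull (suc n) l F ≈[ suc n ] F₂) ∥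

  -- Two zigs into the common target `(apex , top , _)`, with the upper components compared only up
  -- to `≈`. The weaker comparison is what gluing in the lower degree can supply when cospans are
  -- composed.
  record Cospan n {Y X : AbGroup ℓ} (F F′ : ES (suc (suc n)) Y X) : Set (lsuc ℓ) where
    constructor mkCospan
    field
      {apex} : AbGroup ℓ
      u      : Hom (proj₁ F) apex
      v      : Hom (proj₁ F′) apex
      push≡  : pushSES u (proj₂ (proj₂ F)) ≡ pushSES v (proj₂ (proj₂ F′))
      top    : ES (suc n) apex X
      pull-u : pull (suc n) u top ≈[ suc n ] proj₁ (proj₂ F)
      pull-v : pull (suc n) v top ≈[ suc n ] proj₁ (proj₂ F′)

  zig⇒cospan : ∀ n {Y X : AbGroup ℓ} {F F′ : ES (suc (suc n)) Y X} → Zig (suc (suc n)) F F′ → Cospan n F F′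
  zig⇒cospan n {F′ = _ , F′ , E′} (h , e , z) =
    mkCospan h idHom (trans e (sym (pushSES-id E′))) F′
      (≈.sym (suc n) (zig⇒≈ (suc n) z)) (≈.reflexive (suc n) (pull-id (suc n) F′))

  cospan-sym : ∀ n {Y X : AbGroup ℓ} {F F′ : ES (suc (suc n)) Y X} → Cospan n F F′ → Cospan n F′ F
  cospan-sym n (mkCospan u v e T p q) = mkCospan v u (sym e) T q p

  opaque
    pushSES-∘-cong : {Y X X′ L L′ : AbGroup ℓ} (g : Hom L L′) (f : Hom X L) (E : AbSES Y X)
                     (f′ : Hom X′ L) (E′ : AbSES Y X′) →
                     pushSES f E ≡ pushSES f′ E′ → pushSES (g ∘ₕ f) E ≡ pushSES (g ∘ₕ f′) E′
    pushSES-∘-cong g f E f′ E′ e = trans (pushSES-∘ g f E) (trans (cong (pushSES g) e) (sym (pushSES-∘ g f′ E′)))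

  pull-∘-cong : ∀ n {Y Y′ Y″ X : AbGroup ℓ} (g : Hom Y′ Y) (f : Hom Y″ Y′) {F : ES n Y X} {F′ : ES n Y′ X} →
                pull n g F ≈[ n ] F′ → pull n (g ∘ₕ f) F ≈[ n ] pull n f F′
  pull-∘-cong n g f {F} e = ≈.trans n (≈.reflexive n (pull-∘ n g f F)) (pull-cong n f e)

  -- Enlarging the first apex by mid E₂ makes its map from M₂ injective
  -- without changing pushouts of E₂, so that the two cospans can be composed
  -- by gluing over a pushout.
  module _ (n : ℕ) (glue : Gluing n ℓ) {Y X M₁ M₂ M₃ : AbGroup ℓ}
           {F₁ : ES (suc n) M₁ X} {E₁ : AbSES Y M₁}
           {F₂ : ES (suc n) M₂ X} {E₂ : AbSES Y M₂}
           {F₃ : ES (suc n) M₃ X} {E₃ : AbSES Y M₃} where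

    cospan-trans : Cospan n (M₁ , F₁ , E₁) (M₂ , F₂ , E₂) → Cospan n (M₂ , F₂ , E₂) (M₃ , F₃ , E₃) →
                   ∥ Cospan n (M₁ , F₁ , E₁) (M₃ , F₃ , E₃) ∥
    cospan-trans (mkCospan {L} u v e T p q) (mkCospan u′ v′ e′ T′ p′ q′) =
      -- Pulled back along `j`, the second extension becomes the pullback of `T` along `v`, as `out`
      -- undoes the enlargement. It and the pullback of `T′` along `u′` are both `F₂` up to `≈`.
      trunc-map compose (glue isBicartesian j-injective T′ (pull (suc n) out T) agree)
      where
      D : AbGroup ℓ
      D = mid E₂

      in′ : Hom L (D ⊕ L)
      in′ = inʳ

      out : Hom (D ⊕ L) L
      out = outʳ

      j : Hom M₂ (D ⊕ L)
      j = ⟨ incl E₂ , v ⟩ₕ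

      open Pushout u′ j using (P; inj₁; inj₂; isBicartesian)
      module L = AbGroup L
      module D = AbGroup D

      opaque
        j-injective : Injective _≡_ _≡_ ⟦ j ⟧
        j-injective d = AbSES.injective E₂ (cong proj₁ d)

        inj₂∘j≡inj₁∘u′ : inj₂ ∘ₕ j ≡ inj₁ ∘ₕ u′
        inj₂∘j≡inj₁∘u′ = sym (hom-≡ (IsBicartesian.commutes isBicartesian))

        j-homotopic : pushSES (in′ ∘ₕ v) E₂ ≡ pushSES j E₂
        -- `j` differs from `in′ ∘ₕ v` by `inˡ` after `incl E₂`, a map that extends over `mid E₂`.
        j-homotopic = sym (pushSES-homotopic E₂ j (in′ ∘ₕ v) (inˡ {X = D} {L}) λ x →
          cong₂ _,_ (sym (D.identityˡ _)) (sym (L.identityʳ _)))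

        pushSES-agree : pushSES (inj₂ ∘ₕ (in′ ∘ₕ u)) E₁ ≡ pushSES (inj₁ ∘ₕ v′) E₃
        pushSES-agree = trans
          (pushSES-∘-cong inj₂ (in′ ∘ₕ u) E₁ j E₂ (trans (pushSES-∘-cong in′ u E₁ v E₂ e) j-homotopic))
          (trans (cong (λ f → pushSES f E₂) inj₂∘j≡inj₁∘u′) (pushSES-∘-cong inj₁ u′ E₂ v′ E₃ e′))

        pull-out : {Z : AbGroup ℓ} (f : Hom Z (D ⊕ L)) (g : Hom Z L) →
                   (∀ z → proj₂ (⟦ f ⟧ z) ≡ ⟦ g ⟧ z) → pull (suc n) f (pull (suc n) out T) ≈[ suc n ] pull (suc n) g T
        pull-out f g e = ≈.trans (suc n) (≈.sym (suc n) (≈.reflexive (suc n) (pull-∘ (suc n) out f T)))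
          (≈.reflexive (suc n) (cong (λ k → pull (suc n) k T) (hom-≡ e)))

        agree : pull (suc n) u′ T′ ≈[ suc n ] pull (suc n) j (pull (suc n) out T)
        agree = ≈.trans (suc n) p′ (≈.sym (suc n) (≈.trans (suc n) (pull-out j v λ _ → refl) q))

      compose : Σ (ES (suc n) P X) (λ S →
                  pull (suc n) inj₁ S ≈[ suc n ] T′ × pull (suc n) inj₂ S ≈[ suc n ] pull (suc n) out T) →
                Cospan n (M₁ , F₁ , E₁) (M₃ , F₃ , E₃)
      compose (S , S₁ , S₂) = mkCospan (inj₂ ∘ₕ (in′ ∘ₕ u)) (inj₁ ∘ₕ v′) pushSES-agree S
        (≈.trans (suc n) (pull-∘-cong (suc n) inj₂ (in′ ∘ₕ u) S₂)
          (≈.trans (suc n) (pull-out (in′ ∘ₕ u) u λ _ → refl) p))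
        (≈.trans (suc n) (pull-∘-cong (suc n) inj₁ v′ S₁) q′)

  module _ (n : ℕ) (glue : Gluing n ℓ) {Y X : AbGroup ℓ} where

    cospan-isEquivalence : IsEquivalence (λ (F F′ : ES (suc (suc n)) Y X) → ∥ Cospan n F F′ ∥)
    cospan-isEquivalence = record
      { refl  = ∣ zig⇒cospan n (zig-refl (suc (suc n)) refl) ∣
      ; sym   = trunc-map (cospan-sym n)
      ; trans = λ s t → trunc-rec squash (λ s → trunc-rec squash (cospan-trans n glue s) t) s
      }

    -- Truncated cospans form an equivalence relation containing every zig; transitivity is where
    -- gluing one degree lower is spent.
    ≈⇒cospan : {F F′ : ES (suc (suc n)) Y X} → F ≈[ suc (suc n) ] F′ → ∥ Cospan n F F′ ∥
    ≈⇒cospan = ≈-fold (suc (suc n)) squash cospan-isEquivalence (λ z → ∣ zig⇒cospan n z ∣)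

  opaque
    pullSES-pushSES-cong : {Y Y₁ Y₂ X₁ X₂ X : AbGroup ℓ} (g₁ : Hom Y Y₁) (f₁ : Hom X₁ X) (E₁ : AbSES Y₁ X₁)
                           (g₂ : Hom Y Y₂) (f₂ : Hom X₂ X) (E₂ : AbSES Y₂ X₂) →
                           pushSES f₁ (pullSES g₁ E₁) ≡ pushSES f₂ (pullSES g₂ E₂) →
                           pullSES g₁ (pushSES f₁ E₁) ≡ pullSES g₂ (pushSES f₂ E₂)
    pullSES-pushSES-cong g₁ f₁ E₁ g₂ f₂ E₂ e = trans (sym (pull-push g₁ f₁ E₁)) (trans e (pull-push g₂ f₂ E₂))

  -- The left side is `T` spliced with `pushSES u D`; moving `u` across the splice replaces `T` by
  -- `F`.
  pull-splice : ∀ n {L M P Y X : AbGroup ℓ} (k : Hom Y P) (u : Hom M L) (T : ES (suc n) L X)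
                {F : ES (suc n) M X} (D : AbSES Y M) → pull (suc n) u T ≈[ suc n ] F →
                (E : AbSES P L) → pullSES k E ≡ pushSES u D →
                pull (suc (suc n)) k (splice n T E) ≈[ suc (suc n) ] splice n F D
  pull-splice n k u T D p E d = ≈.trans (suc (suc n))
    (≈.sym (suc (suc n)) (splice-push n u (sym d) T)) (splice-cong n D p)

  -- Above degree one, a cospan between the two pullbacks has an apex `L`. Pushed out to `L`, the
  -- extensions `E₁` and `E₂` have equal pullbacks to the source of the square, so they glue, and
  -- the result is spliced with `T`.
  gluing : ∀ n → Gluing n ℓ
  gluing zero sq j-inj F₁ F₂ e = trunc-map
    (λ e → let F , e₁ , e₂ = glueSES sq j-inj F₁ F₂ e in F , ≈.reflexive 1 e₁ , ≈.reflexive 1 e₂)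
    (≈⇒≡ e)
  gluing (suc n) {P = P} {X} {h} {j} {k} {l} sq j-inj (M , F₁ , E₁) (M′ , F₂ , E₂) e =
    trunc-map glue-cospan (≈⇒cospan n (gluing n) e)
    where
    glue-cospan : Cospan n (M , F₁ , pullSES h E₁) (M′ , F₂ , pullSES j E₂) →
                  Σ (ES (suc (suc n)) P X) λ F → pull (suc (suc n)) k F ≈[ suc (suc n) ] (M , F₁ , E₁) ×
                                                 pull (suc (suc n)) l F ≈[ suc (suc n) ] (M′ , F₂ , E₂)
    glue-cospan (mkCospan {L} u v d T p q) =
      let E , d₁ , d₂ = glued
      in splice n T E , pull-splice n k u T E₁ p E d₁ , pull-splice n l v T E₂ q E d₂
      where
      glued : Σ (AbSES P L) λ E → pullSES k E ≡ pushSES u E₁ × pullSES l E ≡ pushSES v E₂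
      glued = glueSES sq j-inj (pushSES u E₁) (pushSES v E₂) (pullSES-pushSES-cong h u E₁ j v E₂ d)

  -- Exactness of the sequence of Ext sets.

  module _ {l m n : ℕ} {Y X Y′ X′ Y″ X″ : AbGroup ℓ}
           (u : ES l Y X → ES m Y′ X′) (u-zig : ∀ {F F′} → Zig l F F′ → Zig m (u F) (u F′))
           (v : ES m Y′ X′ → ES n Y″ X″) (v-zig : ∀ {F F′} → Zig m F F′ → Zig n (v F) (v F′)) where
    private
      u* = Ext-map {m = l} {n = m} u u-zig
      v* = Ext-map {m = m} {n = n} v v-zig
      u*-β = Ext-map-β {m = l} {n = m} u u-zig
      v*-β = Ext-map-β {m = m} {n = n} v v-zig

    -- Effectiveness of the quotient turns equations between classes into `≈` between
    -- representatives, so exactness can be checked on representatives.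
    Ext-map-exact : (∀ F → v (u F) ≈[ n ] ptES n) →
                    (∀ F → v F ≈[ n ] ptES n → ∥ (∃ λ F′ → u F′ ≈[ m ] F) ∥) →
                    ∀ t → ∥ (∃ λ s → u* s ≡ t) ∥ ⇔ v* t ≡ [ ptES n ]
    Ext-map-exact vu≈pt lift-kernel t = mk⇔
      (trunc-rec quot-set λ { (s , refl) → vu*≡pt s })
      (quot-elimProp (λ t → v* t ≡ [ ptES n ] → ∥ (∃ λ s → u* s ≡ t) ∥) (λ _ → Π-prop λ _ → squash)
        (λ F e → trunc-map (λ (F′ , uF′≈F) → [ F′ ] , trans (u*-β F′) ([]-cong m uF′≈F))
          (lift-kernel F ([]-injective n (trans (sym (v*-β F)) e))))
        t)
      where
      vu*≡pt : ∀ s → v* (u* s) ≡ [ ptES n ]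
      vu*≡pt = quot-elimProp (λ s → v* (u* s) ≡ [ ptES n ]) (λ _ → quot-set) λ F →
        trans (cong v* (u*-β F)) (trans (v*-β (u F)) ([]-cong n (vu≈pt F)))

  -- The half of a cospan from `splice n F E` to the base point that matters: the other leg pushes
  -- out a trivial extension, which stays trivial.
  TrivialPush : ∀ n {Y M X : AbGroup ℓ} → ES (suc n) M X → AbSES Y M → Set (lsuc ℓ)
  TrivialPush {ℓ} n {M = M} {X} F E = Σ (AbGroup ℓ) λ L → Σ (Hom M L) λ u → pushSES u E ≡ trivialSES ×
    Σ (ES (suc n) L X) λ T → pull (suc n) u T ≈[ suc n ] F

  ≈pt⇒trivialPush : ∀ n {Y M X : AbGroup ℓ} (F : ES (suc n) M X) (E : AbSES Y M) →
                    splice n F E ≈[ suc (suc n) ] ptES (suc (suc n)) → ∥ TrivialPush n F E ∥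
  ≈pt⇒trivialPush n {Y} {M} F E e = trunc-map untrivialise (≈⇒cospan n (gluing n) e)
    where
    trivial : {Y M K L : AbGroup ℓ} {E : AbSES Y M} (u : Hom M L) (v : Hom K L) →
              pushSES u E ≡ pushSES v trivialSES → pushSES u E ≡ trivialSES
    trivial {Y = Y} {K = K} {E = E} u v d = trans {j = pushSES v (trivialSES {Y = Y} {K})} d (pushSES-trivial v)

    untrivialise : Cospan n (splice n F E) (ptES (suc (suc n))) → TrivialPush n F E
    untrivialise (mkCospan {L} u v d T uT≈F _) = L , u , trivial {Y = Y} {M} {𝟘} {L} {E} u v d , T , uT≈F

  module _ {A B G : AbGroup ℓ} (ℰ : AbSES B A) (n : ℕ) where
    private
      module ℰ = AbSES ℰ

    -- Moving `incl ℰ` across the splice pushes `ℰ` out along its own inclusion, and the identity of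
    -- `mid ℰ` splits the result.
    splice-pull-incl : (F : ES (suc n) (mid ℰ) G) → splice n (pull (suc n) (incl ℰ) F) ℰ ≈[ suc (suc n) ] ptES (suc (suc n))
    splice-pull-incl F = ≈.trans (suc (suc n))
      (splice-push n (incl ℰ) (extension⇒pushSES-trivial (incl ℰ) ℰ idHom λ _ → refl) F) (splice-trivial n F)

    -- Since `pushSES u ℰ` splits, `u` extends to `r` on `mid ℰ`; pulling `T` back along `r` gives
    -- the preimage.
    splice-kernel : (F : ES (suc n) A G) → splice n F ℰ ≈[ suc (suc n) ] ptES (suc (suc n)) →
                    ∥ (∃ λ F′ → pull (suc n) (incl ℰ) F′ ≈[ suc n ] F) ∥
    splice-kernel F e = trunc-map
      (λ (L , u , d , T , uT≈F) →
        let r , r-incl = pushSES-trivial⇒extension u ℰ d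
        in pull (suc n) r T , ≈.trans (suc n)
             (≈.sym (suc n) (≈.reflexive (suc n) (pull-∘ (suc n) r (incl ℰ) T)))
             (≈.trans (suc n) (≈.reflexive (suc n) (cong (λ f → pull (suc n) f T) (hom-≡ r-incl))) uT≈F))
      (≈pt⇒trivialPush n F ℰ e)

    -- The identity lifts `proj ℰ` through itself, so the pullback of `ℰ` splits.
    pull-proj-splice : (F : ES (suc n) A G) →
                       pull (suc (suc n)) (proj ℰ) (splice n F ℰ) ≈[ suc (suc n) ] ptES (suc (suc n))
    pull-proj-splice F = ≈.trans (suc (suc n))
      (≈.reflexive (suc (suc n)) (cong (splice n F) (lift⇒pullSES-trivial (proj ℰ) ℰ idHom λ _ → refl)))
      (splice-trivial n F)

    -- `pushSES u D` splits over `mid ℰ`, hence equals `pushSES w ℰ` for some `w`. Moving `w` and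
    -- `u` across the splices with `T` connects the pullback of `T` along `w`, spliced with `ℰ`, to
    -- the given element.
    pull-proj-kernel : (F : ES (suc (suc n)) B G) → pull (suc (suc n)) (proj ℰ) F ≈[ suc (suc n) ] ptES (suc (suc n)) →
                       ∥ (∃ λ F′ → splice n F′ ℰ ≈[ suc (suc n) ] F) ∥
    pull-proj-kernel (M , F , D) e = trunc-map
      (λ (L , u , d , T , uT≈F) →
        let w , wℰ≡uD = pullSES-proj-trivial⇒pushSES ℰ (pushSES u D)
              (trans {j = pushSES u (pullSES (proj ℰ) D)} (sym (pull-push (proj ℰ) u D)) d)
        in pull (suc n) w T , ≈.trans (suc (suc n)) (splice-push n w wℰ≡uD T)
             (≈.trans (suc (suc n)) (≈.sym (suc (suc n)) (splice-push n u refl T)) (splice-cong n D uT≈F)))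
      (≈pt⇒trivialPush n F (pullSES (proj ℰ) D) e)

    pull-incl-pull-proj : (F : ES (suc n) B G) → pull (suc n) (incl ℰ) (pull (suc n) (proj ℰ) F) ≈[ suc n ] ptES (suc n)
    pull-incl-pull-proj F = ≈.trans (suc n) (≈.sym (suc n) (≈.reflexive (suc n) (pull-∘ (suc n) (proj ℰ) (incl ℰ) F)))
      (≈.trans (suc n) (≈.reflexive (suc n) (cong (λ f → pull (suc n) f F) (hom-≡ ℰ.complex))) (pull-zero n F))

    incl-proj-isBicartesian : IsBicartesian (zeroHom {Y = 𝟘}) (incl ℰ) zeroHom (proj ℰ)
    incl-proj-isBicartesian = record
      { commutes = λ a → sym (ℰ.complex a)
      ; covers   = λ b → trunc-map (λ (e , pe≡b) → tt , e , trans (AbGroup.identityˡ B _) pe≡b) (ℰ.surjective b)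
      ; exact    = λ _ e ε≡pe → trunc-map (λ (a , ia≡e) → a , refl , ia≡e) (ℰ.exact e (sym ε≡pe))
      }

    -- The base point over `𝟘` and `F` over `mid ℰ` agree on `A`, so they glue to an element over
    -- `B`.
    pull-incl-kernel : (F : ES (suc n) (mid ℰ) G) → pull (suc n) (incl ℰ) F ≈[ suc n ] ptES (suc n) →
                       ∥ (∃ λ F′ → pull (suc n) (proj ℰ) F′ ≈[ suc n ] F) ∥
    pull-incl-kernel F e = trunc-map (λ (F′ , _ , pF′≈F) → F′ , pF′≈F)
      (gluing n incl-proj-isBicartesian ℰ.injective (ptES (suc n)) F
        (≈.trans (suc n) (≈.reflexive (suc n) (pull-pt (suc n) zeroHom)) (≈.sym (suc n) e)))

    exact-at-Ext-A : IsExactAt (Ext (suc n) A G) {Ext (suc n) (mid ℰ) G} {Ext (suc (suc n)) B G} (incl ℰ ⋆) (▷ ℰ)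
    exact-at-Ext-A = Ext-map-exact {l = suc n} {suc n} {suc (suc n)} {mid ℰ} {G} {A} {G} {B} {G}
      (pull (suc n) (incl ℰ)) (zig-pull (suc n) (incl ℰ)) (λ F → splice n F ℰ) (zig-splice n ℰ)
      splice-pull-incl splice-kernel

    exact-at-Ext-B : IsExactAt (Ext (suc (suc n)) B G) {Ext (suc n) A G} {Ext (suc (suc n)) (mid ℰ) G} (▷ ℰ) (proj ℰ ⋆)
    exact-at-Ext-B = Ext-map-exact {l = suc n} {suc (suc n)} {suc (suc n)} {A} {G} {B} {G} {mid ℰ} {G}
      (λ F → splice n F ℰ) (zig-splice n ℰ) (pull (suc (suc n)) (proj ℰ)) (zig-pull (suc (suc n)) (proj ℰ))
      pull-proj-splice pull-proj-kernel

    exact-at-Ext-E : IsExactAt (Ext (suc n) (mid ℰ) G) {Ext (suc n) B G} {Ext (suc n) A G} (proj ℰ ⋆) (incl ℰ ⋆)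
    exact-at-Ext-E = Ext-map-exact {l = suc n} {suc n} {suc n} {B} {G} {mid ℰ} {G} {A} {G}
      (pull (suc n) (proj ℰ)) (zig-pull (suc n) (proj ℰ)) (pull (suc n) (incl ℰ)) (zig-pull (suc n) (incl ℰ))
      pull-incl-pull-proj pull-incl-kernel

theorem26 : (ua : Univalence) (hits : HITs) →
  let open Yoneda ua hits in
  {ℓ : Level} {A B G : AbGroup ℓ} (ℰ : AbSES B A) →
  let E = AbSES.mid ℰ
      i = AbSES.incl ℰ
      p = AbSES.proj ℰ
  in
  (n : ℕ) →
  IsExactAt (Ext (suc n) A G) {Ext (suc n) E G} {Ext (suc (suc n)) B G} (i ⋆) (▷ ℰ) ×
  IsExactAt (Ext (suc (suc n)) B G) {Ext (suc n) A G} {Ext (suc (suc n)) E G} (▷ ℰ) (p ⋆) ×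
  IsExactAt (Ext (suc (suc n)) E G) {Ext (suc (suc n)) B G} {Ext (suc (suc n)) A G} (p ⋆) (i ⋆)
theorem26 ua hits {A = A} {B} {G} ℰ n =
  exact-at-Ext-A {A = A} {B} {G} ℰ n ,
  exact-at-Ext-B {A = A} {B} {G} ℰ n ,
  -- The argument is one below the degree, and exactness is wanted here in degree `suc (suc n)`.
  exact-at-Ext-E {A = A} {B} {G} ℰ (suc n)
  where open ExtExactness ua hits
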